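{- Let $k\ge 2$ be fixed. Asymptotically almost surely (i.e. with probability tending to $1$ as $n\to\infty$), $T\sim\mathcal{R}(n,k)$ has the property that every minimal feedback arc set of $T$ contains $n-k+1$ pairwise vertex-disjoint $k$-cliques.
   Context: $\mathcal{R}(n,k)$ denotes the probability space of $k$-partite tournaments with vertex classes $A_1,\ldots,A_k$, each of size $n$, where every edge between distinct classes is oriented independently and uniformly at random. A feedback arc set of a directed graph $T$ is a set of edges (viewed as a spanning subgraph) meeting every directed cycle; it is minimal if no proper subset of it is a feedback arc set. A $k$-clique in a feedback arc set $H$ is a set of $k$ vertices that are pairwise adjacent in $H$. -}

module Defs where

open import Data.Bool using (Bool; true; false; not; T)
open import Data.Bool.Properties using (T?; not-involutive)
open import Data.Fin using (Fin; zero; suc)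
import Data.Fin.Properties as Fin
open import Data.Fin.Subset.Properties using (anySubset?)
open import Data.Integer using (+_)
open import Data.List using (List; []; _∷_; length; filter; cartesianProductWith)
open import Data.Nat as ℕ using (ℕ; zero; suc; _∸_; _≤_; NonZero)
open import Data.Nat.Properties using (allUpTo?)
open import Data.Product using (Σ; ∃; ∃-syntax; _×_; _,_; proj₁)
open import Data.Product.Function.NonDependent.Propositional using (_×-↔_)
open import Data.Rational as ℚ using (ℚ; 0ℚ; _/_; ∣_∣)
open import Data.Sum using (_⊎_; map)
open import Data.Vec using (Vec; []; _∷_; _∷ʳ_; zip; lookup; tabulate)
open import Data.Vec.Properties using (lookup∘tabulate)
open import Data.Vec.Membership.Propositional using (_∈_)
open import Data.Vec.Relation.Unary.All as All using (All)
open import Data.Vec.Relation.Unary.Any as Any using (Any)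
open import Data.Vec.Relation.Unary.AllPairs using (AllPairs; allPairs?)
  renaming (map to mapPairs)
open import Data.Vec.Relation.Unary.Unique.Propositional using (Unique)
open import Data.Vec.Relation.Unary.Unique.Propositional.Properties using (lookup-injective)
open import Function using (_∘_; _↔_; Inverse; Injective; it)
open import Function.Construct.Composition using (_↔-∘_)
open import Level using (Level; 0ℓ)
open import Relation.Binary.PropositionalEquality
  using (_≡_; _≢_; _≗_; refl; sym; trans; cong; subst)
open import Relation.Nullary using (¬_; Dec; contradiction)
open import Relation.Nullary.Decidable
  using (map′; ¬?; _×-dec_; _⊎-dec_; _→-dec_; decidable-stable)
open import Relation.Unary using (Pred; Decidable; _⊆_; _⊂_)

private
  variable
    ℓ : Level
    A V : Set
    k m n N M : ℕ

-- A digraph on V is identified with its set of arcs; (u , v) is the arc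
-- from u to v.  Bool-valued predicates are exactly the subsets of V × V
-- when V is finite.
ArcSet : Set → Set
ArcSet V = V × V → Bool

⟦_⟧ : ArcSet V → Pred (V × V) 0ℓ
⟦ D ⟧ = T ∘ D

-- The arcs v₀→v₁, …, vₘ₋₁→vₘ, vₘ→v₀ of the closed walk through v₀, …, vₘ.
closedWalk : Vec V (suc m) → Vec (V × V) (suc m)
closedWalk (v ∷ vs) = zip (v ∷ vs) (vs ∷ʳ v)

IsCycle : ArcSet V → Vec V (suc m) → Set
IsCycle D c = Unique c × All ⟦ D ⟧ (closedWalk c)

IsFeedbackArcSet : ArcSet V → ArcSet V → Set
IsFeedbackArcSet D F =
  ⟦ F ⟧ ⊆ ⟦ D ⟧ ×
  (∀ {m} (c : Vec _ (suc m)) → IsCycle D c → Any ⟦ F ⟧ (closedWalk c))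

IsMinimalFeedbackArcSet : ArcSet V → ArcSet V → Set
IsMinimalFeedbackArcSet D F =
  IsFeedbackArcSet D F ×
  (∀ F′ → ⟦ F′ ⟧ ⊂ ⟦ F ⟧ → ¬ IsFeedbackArcSet D F′)

Adjacent : ArcSet V → V → V → Set
Adjacent H u v = T (H (u , v)) ⊎ T (H (v , u))

IsClique : ArcSet V → Vec V k → Set
IsClique H C = Unique C × AllPairs (Adjacent H) C

Disjoint : Vec V m → Vec V n → Set
Disjoint C C′ = ∀ v → ¬ (v ∈ C × v ∈ C′)

HasDisjointCliques : ArcSet V → (m k : ℕ) → Set
HasDisjointCliques H m k =
  Σ (Vec (Vec _ k) m) λ Cs → All (IsClique H) Cs × AllPairs Disjoint Cs

-- The vertex (i , a) is the a-th vertex of the i-th class.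
Vertex : ℕ → ℕ → Set
Vertex n k = Fin k × Fin n

-- One bit for every pair of vertices in distinct classes: in M ∷ τ, the bit
-- M[j][a][b] orients the edge between (0 , a) and (suc j , b), with true
-- meaning (0 , a) → (suc j , b), and τ orients the edges among the classes
-- other than 0.
data Tournament (n : ℕ) : ℕ → Set where
  []  : Tournament n 0
  _∷_ : Vec (Vec (Vec Bool n) n) k → Tournament n k → Tournament n (suc k)

arcs : Tournament n k → ArcSet (Vertex n k)
arcs (M ∷ τ) ((zero  , a) , (zero  , b)) = false
arcs (M ∷ τ) ((zero  , a) , (suc j , b)) = lookup (lookup (lookup M j) a) b
arcs (M ∷ τ) ((suc i , a) , (zero  , b)) = not (lookup (lookup (lookup M i) b) a)
arcs (M ∷ τ) ((suc i , a) , (suc j , b)) = arcs τ ((i , a) , (j , b))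

arcs-within : (τ : Tournament n k) (i : Fin k) (a b : Fin n) →
              arcs τ ((i , a) , (i , b)) ≡ false
arcs-within (M ∷ τ) zero    a b = refl
arcs-within (M ∷ τ) (suc i) a b = arcs-within τ i a b

arcs-between : (τ : Tournament n k) {i j : Fin k} (a b : Fin n) → i ≢ j →
               arcs τ ((j , b) , (i , a)) ≡ not (arcs τ ((i , a) , (j , b)))
arcs-between (M ∷ τ) {zero}  {zero}  a b i≢j = contradiction refl i≢j
arcs-between (M ∷ τ) {zero}  {suc j} a b i≢j = refl
arcs-between (M ∷ τ) {suc i} {zero}  a b i≢j = sym (not-involutive _)
arcs-between (M ∷ τ) {suc i} {suc j} a b i≢j = arcs-between τ a b (i≢j ∘ cong suc)

-- n - k + 1 is rendered as suc n ∸ k, which agrees with it whenever it is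
-- nonnegative, and is 0 otherwise.
Good : Tournament n k → Set
Good {n} {k} τ =
  ∀ H → IsMinimalFeedbackArcSet (arcs τ) H → HasDisjointCliques H (suc n ∸ k) k

Searchable : Set → Set₁
Searchable A = ∀ {P : Pred A 0ℓ} → Decidable P → Dec (∃ P)

all? : Searchable A → {P : Pred A 0ℓ} → Decidable P → Dec (∀ x → P x)
all? any? P? = map′
  (λ ¬∃¬ x → decidable-stable (P? x) (λ ¬p → ¬∃¬ (x , ¬p)))
  (λ ∀p (x , ¬p) → ¬p (∀p x))
  (¬? (any? (¬? ∘ P?)))

searchVec : Searchable A → ∀ m → Searchable (Vec A m)
searchVec any? zero    P? = map′ ([] ,_) (λ { ([] , p) → p }) (P? [])
searchVec any? (suc m) P? = map′
  (λ (x , xs , p) → x ∷ xs , p)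
  (λ { (x ∷ xs , p) → x , xs , p })
  (any? λ x → searchVec any? m (P? ∘ (x ∷_)))

search↔ : Fin N ↔ A → Searchable A
search↔ e {P} P? = map′
  (λ (i , p) → to i , p)
  (λ (x , p) → from x , subst P (sym (strictlyInverseˡ x)) p)
  (Fin.any? (P? ∘ to))
  where open Inverse e

-- Arc sets are searched up to pointwise equality.
searchArcSet : Fin N ↔ (V × V) → {P : Pred (ArcSet V) 0ℓ} →
               (∀ {F G} → F ≗ G → P F → P G) →
               Decidable P → Dec (∃ P)
searchArcSet e resp P? = map′
  (λ (S , p) → lookup S ∘ from , p)
  (λ (F , p) → tabulate (F ∘ to) ,
     resp (λ x → sym (trans (lookup∘tabulate (F ∘ to) (from x))
                            (cong F (strictlyInverseˡ x)))) p)
  (anySubset? λ S → P? (lookup S ∘ from))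
  where open Inverse e

feedback-resp : {D F G : ArcSet V} → F ≗ G →
                IsFeedbackArcSet D F → IsFeedbackArcSet D G
feedback-resp F≗G (F⊆D , meets) =
  (λ {x} → F⊆D ∘ subst T (sym (F≗G x))) ,
  (λ c isCycle → Any.map (λ {x} → subst T (F≗G x)) (meets c isCycle))

minimal-resp : {D F G : ArcSet V} → F ≗ G →
               IsMinimalFeedbackArcSet D F → IsMinimalFeedbackArcSet D G
minimal-resp {D = D} {F} {G} F≗G (fas , min) =
  feedback-resp {D = D} F≗G fas ,
  λ F′ (F′⊆G , G⊈F′) → min F′
    ( (λ {x} → subst T (sym (F≗G x)) ∘ F′⊆G)
    , (λ F⊆F′ → G⊈F′ λ {x} → F⊆F′ ∘ subst T (sym (F≗G x))))

-- A cycle has distinct vertices, so on N vertices only the cycles of length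
-- at most N have to be searched.
module _ (e : Fin N ↔ V) (e² : Fin M ↔ (V × V)) where

  open Inverse e using (to; from; strictlyInverseˡ)

  private
    from-injective : Injective _≡_ _≡_ from
    from-injective {x} {y} eq =
      trans (sym (strictlyInverseˡ x)) (trans (cong to eq) (strictlyInverseˡ y))

    _≟ⱽ_ : (x y : V) → Dec (x ≡ y)
    x ≟ⱽ y = map′ from-injective (cong from) (from x Fin.≟ from y)

    searchV : Searchable V
    searchV = search↔ e

    unique? : Decidable (Unique {A = V} {n})
    unique? = allPairs? λ x y → ¬? (x ≟ⱽ y)

    ⟦_⟧⊆?_ : (F G : ArcSet V) → Dec (⟦ F ⟧ ⊆ ⟦ G ⟧)
    ⟦ F ⟧⊆? G = map′ (λ f {x} → f x) (λ f x → f)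
      (all? (search↔ e²) λ x → T? (F x) →-dec T? (G x))

    cycle-length : (c : Vec V n) → Unique c → n ≤ N
    cycle-length c uc = Fin.injective⇒≤ {f = from ∘ lookup c}
      λ eq → lookup-injective uc _ _ (from-injective eq)

  isFeedbackArcSet? : (D F : ArcSet V) → Dec (IsFeedbackArcSet D F)
  isFeedbackArcSet? D F = (⟦ F ⟧⊆? D) ×-dec map′
    (λ f {l} c isCycle → f {l} (cycle-length c (proj₁ isCycle)) c isCycle)
    (λ f {l} _ c → f {l} c)
    (allUpTo? {P = λ l → (c : Vec V (suc l)) → IsCycle D c → Any ⟦ F ⟧ (closedWalk c)}
      (λ l → all? (searchVec searchV (suc l)) λ c →
       (unique? c ×-dec All.all? (T? ∘ D) (closedWalk c))
         →-dec Any.any? (T? ∘ F) (closedWalk c)) N)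

  isMinimalFeedbackArcSet? : (D F : ArcSet V) → Dec (IsMinimalFeedbackArcSet D F)
  isMinimalFeedbackArcSet? D F = isFeedbackArcSet? D F ×-dec map′
    (λ ¬∃ F′ F′⊂F fas → ¬∃ (F′ , F′⊂F , fas))
    (λ min (F′ , F′⊂F , fas) → min F′ F′⊂F fas)
    (¬? (searchArcSet e²
      (λ F≗G ((F⊆ , F⊉) , fas) →
        ( (λ {x} → F⊆ ∘ subst T (sym (F≗G x)))
        , (λ ⊆G → F⊉ λ {x} → subst T (sym (F≗G x)) ∘ ⊆G)) ,
        feedback-resp {D = D} F≗G fas)
      λ F′ → ((⟦ F′ ⟧⊆? F) ×-dec ¬? (⟦ F ⟧⊆? F′)) ×-dec isFeedbackArcSet? D F′))

  hasDisjointCliques? : (H : ArcSet V) (l k : ℕ) → Dec (HasDisjointCliques H l k)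
  hasDisjointCliques? H l k = searchVec (searchVec searchV k) l λ Cs →
    All.all? (λ C → unique? C ×-dec allPairs? adjacent? C) Cs
      ×-dec allPairs? disjoint? Cs
    where
    adjacent? : (u v : V) → Dec (Adjacent H u v)
    adjacent? u v = T? (H (u , v)) ⊎-dec T? (H (v , u))

    disjoint? : (C C′ : Vec V k) → Dec (Disjoint C C′)
    disjoint? C C′ = all? searchV λ v →
      ¬? (Any.any? (v ≟ⱽ_) C ×-dec Any.any? (v ≟ⱽ_) C′)

  minimalHasDisjointCliques? : (D : ArcSet V) (l k : ℕ) →
    Dec (∀ H → IsMinimalFeedbackArcSet D H → HasDisjointCliques H l k)
  minimalHasDisjointCliques? D l k = map′
    (λ ¬∃ H min → decidable-stable (hasDisjointCliques? H l k)
                    λ ¬cliques → ¬∃ (H , min , ¬cliques))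
    (λ f (H , min , ¬cliques) → ¬cliques (f H min))
    (¬? (searchArcSet e²
      (λ F≗G (min , ¬cliques) →
        minimal-resp {D = D} F≗G min , ¬cliques ∘ cliques-resp (sym ∘ F≗G))
      λ H → isMinimalFeedbackArcSet? D H ×-dec ¬? (hasDisjointCliques? H l k)))
    where
    cliques-resp : {F G : ArcSet V} → F ≗ G →
                   HasDisjointCliques F l k → HasDisjointCliques G l k
    cliques-resp F≗G (Cs , cliques , disj) =
      Cs ,
      All.map (λ (u , adj) →
        u , mapPairs (map (subst T (F≗G _)) (subst T (F≗G _))) adj) cliques ,
      disj

good? : Decidable (Good {n} {k})
good? {n} {k} τ = minimalHasDisjointCliques? Fin.*↔× square (arcs τ) (suc n ∸ k) k
  where
  square : Fin ((k ℕ.* n) ℕ.* (k ℕ.* n)) ↔ (Vertex n k × Vertex n k)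
  square = (Fin.*↔× ×-↔ Fin.*↔×) ↔-∘ Fin.*↔×

vectors : List A → ∀ m → List (Vec A m)
vectors xs zero    = [] ∷ []
vectors xs (suc m) = cartesianProductWith _∷_ xs (vectors xs m)

-- Every tournament, listed exactly once.  Independent fair orientations of
-- the edges amount to the uniform distribution on this list.
tournaments : ∀ n k → List (Tournament n k)
tournaments n zero    = [] ∷ []
tournaments n (suc k) = cartesianProductWith _∷_
  (vectors (vectors (vectors (true ∷ false ∷ []) n) n) k)
  (tournaments n k)

product-nonZero : {A B C : Set} (f : A → B → C) (xs : List A) (ys : List B) →
                  .{{NonZero (length xs)}} → .{{NonZero (length ys)}} →
                  NonZero (length (cartesianProductWith f xs ys))
product-nonZero f (x ∷ xs) (y ∷ ys) = _

vectors-nonZero : (xs : List A) .{{_ : NonZero (length xs)}} → ∀ m →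
                  NonZero (length (vectors xs m))
vectors-nonZero xs zero    = _
vectors-nonZero xs (suc m) =
  product-nonZero _∷_ xs (vectors xs m) {{it}} {{vectors-nonZero xs m}}

tournaments-nonZero : ∀ n k → NonZero (length (tournaments n k))
tournaments-nonZero n zero    = _
tournaments-nonZero n (suc k) = product-nonZero _∷_ (vectors rows k) (tournaments n k)
  {{vectors-nonZero rows {{rows≢0}} k}} {{tournaments-nonZero n k}}
  where
  bits = vectors (true ∷ false ∷ []) n
  rows = vectors bits n
  rows≢0 = vectors-nonZero bits {{vectors-nonZero (true ∷ false ∷ []) n}} n

uniform : (xs : List A) .{{_ : NonZero (length xs)}} {P : Pred A ℓ} → Decidable P → ℚ
uniform xs P? = + length (filter P? xs) / length xs

Prℛ : ∀ n k {P : Pred (Tournament n k) ℓ} → Decidable P → ℚ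
Prℛ n k P? = uniform (tournaments n k) {{tournaments-nonZero n k}} P?

_⟶_ : (ℕ → ℚ) → ℚ → Set
f ⟶ L = ∀ ε → 0ℚ ℚ.< ε → ∃[ n₀ ] ∀ n → n₀ ≤ n → ∣ f n ℚ.- L ∣ ℚ.< ε

{-# OPTIONS --safe #-}
module Submission where

-- The arcs of T outside a feedback arc set H form an acyclic digraph, so some
-- height function decreases along them, and every arc of T along which the
-- height does not decrease lies in H.  A union bound over the possible heights
-- shows that a.a.s. this forces, for any k² large families of disjoint
-- transversals, a choice of one transversal per family such that all pairs of
-- chosen transversals are completely joined in H.  Another union bound shows
-- that a.a.s. any two vertices of a class lie, together with vertices of any
-- other class, on many 4-cycles, each of which meets H; hence at most one
-- vertex of A_i has few H-neighbours in A_j.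
--
-- Given m ≤ n - k disjoint k-cliques of H, one more is gained as follows.  If
-- many vertices are uncovered, join transversals of them.  Otherwise each A_i
-- has at least k uncovered vertices, one of which, u_i, has many H-neighbours
-- in each of the other k - 1 classes.  Choose completely joined cliques R_ij of
-- the packing such that u_i is adjacent to the j-th vertex of R_ij for i ≠ j,
-- and retile the R_ij and the u_i.
open import Defs
open import Data.Bool using (Bool; true; false; not; T; _∧_; _∨_; _xor_)
open import Data.Bool.Properties as Bool using (T?)
open import Data.Empty using (⊥-elim)
open import Data.Fin as Fin
  using (Fin; zero; suc; toℕ; fromℕ<; combine; remQuot; inject≤; funToFin; finToFun;
         punchIn; punchOut; splitAt; _↑ˡ_; _↑ʳ_)
open import Data.Fin.Patterns using (0F; 1F; 2F; 3F)
import Data.Fin.Properties as Fin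
import Data.Integer as ℤ
import Data.Integer.Properties as ℤ
open import Data.List using (List; []; _∷_; length; map; _++_; filter; cartesianProductWith)
open import Data.Maybe using (Maybe; just; nothing)
open import Data.Nat as ℕ hiding (_≟_; _/_)
open import Data.Nat.DivMod using (m≡m%n+[m/n]*n; m%n<n; m*n/n≡m; /-monoˡ-≤)
open import Data.Nat.Properties hiding (_≟_)
open import Algebra.Properties.CommutativeSemigroup +-commutativeSemigroup using ()
  renaming (interchange to +-interchange; x∙yz≈y∙xz to +-exchange)
open import Algebra.Properties.CommutativeSemigroup *-commutativeSemigroup using ()
  renaming (interchange to *-interchange; x∙yz≈y∙xz to *-exchange)
open import Data.Nat.Tactic.RingSolver using (solve-∀)
open import Data.Product using (∃; ∃-syntax; Σ; Σ-syntax; _×_; _,_; proj₁; proj₂; swap; uncurry)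
open import Data.Product.Properties using (≡-dec; ,-injectiveˡ; ,-injectiveʳ)
open import Data.Rational as ℚ using (ℚ; mkℚ; 0ℚ; 1ℚ; _/_; toℚᵘ)
import Data.Rational.Properties as ℚ
open import Data.Rational.Unnormalised as ℚᵘ using (mkℚᵘ; *≡*; *<*)
import Data.Rational.Unnormalised.Properties as ℚᵘ
open import Data.Sum as Sum using (_⊎_; inj₁; inj₂; [_,_]′)
open import Data.Unit using (⊤; tt)
open import Data.Vec using (Vec; []; _∷_; _∷ʳ_; zip; lookup; tabulate)
open import Data.Vec.Membership.Propositional using (_∈_)
open import Data.Vec.Membership.Propositional.Properties using (∈-lookup)
open import Data.Vec.Properties using (lookup∘tabulate)
open import Data.Vec.Relation.Unary.All as All using (All; []; _∷_)
import Data.Vec.Relation.Unary.All.Properties as All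
open import Data.Vec.Relation.Unary.AllPairs using ([]; _∷_)
import Data.Vec.Relation.Unary.AllPairs.Properties as AllPairs
open import Data.Vec.Relation.Unary.Any as Any using (Any; here; there)
import Data.Vec.Relation.Unary.Any.Properties as Any
open import Data.Vec.Relation.Unary.Linked using (Linked; []; [-]; _∷_)
open import Data.Vec.Relation.Unary.Unique.Propositional using (Unique)
import Data.Vec.Relation.Unary.Unique.Propositional.Properties as Unique
open import Function using (_∘_; id; _↔_; Inverse)
open import Level using (Level; 0ℓ)
open import Relation.Binary.Definitions using (DecidableEquality; tri<; tri≈; tri>)
open import Relation.Binary.PropositionalEquality
open import Relation.Nullary using (¬_; Dec; yes; no; does; contradiction)
open import Relation.Nullary.Decidable using (¬?; _×-dec_; _⊎-dec_; _→-dec_; dec-true; dec-false)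
open import Relation.Unary using (Pred; Decidable)

private
  variable
    ℓ : Level
    A B C I : Set
    b c d h k m n q s t : ℕ

-- Counting independent events

∧⁺ : ∀ {x y} → T x → T y → T (x ∧ y)
∧⁺ {true} _ t = t

∧⁻ : ∀ {x y} → T (x ∧ y) → T x × T y
∧⁻ {true} t = tt , t

¬not⁻ : ∀ {x} → ¬ T (not x) → T x
¬not⁻ {true}  _ = tt
¬not⁻ {false} f = f tt

allF : (Fin n → Bool) → Bool
allF {zero}  f = true
allF {suc n} f = f zero ∧ allF (f ∘ suc)

anyF : (Fin n → Bool) → Bool
anyF {zero}  f = false
anyF {suc n} f = f zero ∨ anyF (f ∘ suc)

allF⁻ : (f : Fin n → Bool) → T (allF f) → ∀ i → T (f i)
allF⁻ {suc n} f t i with f zero in eq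
allF⁻ {suc n} f t zero    | true = subst T (sym eq) tt
allF⁻ {suc n} f t (suc i) | true = allF⁻ (f ∘ suc) t i

allF⁺ : (f : Fin n → Bool) → (∀ i → T (f i)) → T (allF f)
allF⁺ {zero}  f t = tt
allF⁺ {suc n} f t with f zero | t zero
... | true | _ = allF⁺ (f ∘ suc) (t ∘ suc)

¬allF⁻ : (f : Fin n → Bool) → ¬ T (allF f) → ∃ λ i → ¬ T (f i)
¬allF⁻ {zero}  f ¬t = ⊥-elim (¬t tt)
¬allF⁻ {suc n} f ¬t with f zero in eq
... | false = zero , subst T eq
... | true  with i , ¬p ← ¬allF⁻ (f ∘ suc) ¬t = suc i , ¬p

allF-cong : {f g : Fin n → Bool} → f ≗ g → allF f ≡ allF g
allF-cong {zero}  f≗g = refl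
allF-cong {suc n} f≗g = cong₂ _∧_ (f≗g zero) (allF-cong (f≗g ∘ suc))

anyF⁺ : (f : Fin n → Bool) (i : Fin n) → T (f i) → T (anyF f)
anyF⁺ f zero t with f zero
... | true = tt
anyF⁺ f (suc i) t with f zero
... | true  = tt
... | false = anyF⁺ (f ∘ suc) i t

anyF⁻ : (f : Fin m → Bool) → T (anyF f) → ∃ λ i → T (f i)
anyF⁻ {suc m} f t with f zero in eq
... | true  = zero , subst T (sym eq) tt
... | false with i , p ← anyF⁻ (f ∘ suc) t = suc i , p

∑ : List A → (A → ℕ) → ℕ
∑ []       g = 0
∑ (x ∷ xs) g = g x + ∑ xs g

∑-cong : (xs : List A) {f g : A → ℕ} → f ≗ g → ∑ xs f ≡ ∑ xs g
∑-cong []       f≗g = refl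
∑-cong (x ∷ xs) f≗g = cong₂ _+_ (f≗g x) (∑-cong xs f≗g)

𝟙 : Bool → ℕ
𝟙 true  = 1
𝟙 false = 0

count : List A → (A → Bool) → ℕ
count xs p = ∑ xs (𝟙 ∘ p)

module _ (xs : List A) where

  count-true : count xs (λ _ → true) ≡ length xs
  count-true = go xs
    where
    go : ∀ ys → count ys (λ _ → true) ≡ length ys
    go []       = refl
    go (_ ∷ ys) = cong suc (go ys)

  count-false : count xs (λ _ → false) ≡ 0
  count-false = go xs
    where
    go : ∀ ys → count ys (λ _ → false) ≡ 0
    go []       = refl
    go (_ ∷ ys) = go ys

  count-⊎ : (p q r : A → Bool) → (∀ a → T (p a) → T (q a) ⊎ T (r a)) →
            count xs p ≤ count xs q + count xs r
  count-⊎ p q r f = go xs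
    where
    at : ∀ a → 𝟙 (p a) ≤ 𝟙 (q a) + 𝟙 (r a)
    at a with p a | q a | r a | f a
    ... | false | _     | _     | _ = z≤n
    ... | true  | true  | _     | _ = s≤s z≤n
    ... | true  | false | true  | _ = s≤s z≤n
    ... | true  | false | false | g with g tt
    ...   | inj₁ ()
    ...   | inj₂ ()

    go : ∀ ys → count ys p ≤ count ys q + count ys r
    go []       = z≤n
    go (y ∷ ys) = begin
      𝟙 (p y) + count ys p                               ≤⟨ +-mono-≤ (at y) (go ys) ⟩
      (𝟙 (q y) + 𝟙 (r y)) + (count ys q + count ys r)     ≡⟨ +-interchange (𝟙 (q y)) _ _ _ ⟩
      (𝟙 (q y) + count ys q) + (𝟙 (r y) + count ys r)     ∎
      where
      open ≤-Reasoning

  count-split : (p q : A → Bool) →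
                count xs (λ a → q a ∧ p a) + count xs (λ a → not (q a) ∧ p a) ≡ count xs p
  count-split p q = go xs
    where
    go : ∀ ys → count ys (λ a → q a ∧ p a) + count ys (λ a → not (q a) ∧ p a) ≡ count ys p
    go [] = refl
    go (y ∷ ys) with q y
    ... | true  = trans (+-assoc (𝟙 (p y)) _ _) (cong (𝟙 (p y) +_) (go ys))
    ... | false = trans (+-exchange (count ys (λ a → q a ∧ p a)) (𝟙 (p y)) _)
                        (cong (𝟙 (p y) +_) (go ys))

  never-rare : ∀ L {Y} → L * count xs (λ _ → false) ≤ Y
  never-rare L = ≤-trans (≤-reflexive (trans (cong (L *_) count-false) (*-zeroʳ L))) z≤n

  union-bound : ∀ N L Y (ev : Fin N → A → Bool) → (∀ c → L * count xs (ev c) ≤ Y) →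
                L * count xs (λ a → anyF (λ c → ev c a)) ≤ N * Y
  union-bound zero    L Y ev bound = never-rare L
  union-bound (suc N) L Y ev bound = begin
    L * count xs (λ a → ev zero a ∨ anyF (λ c → ev (suc c) a))
      ≤⟨ *-monoʳ-≤ L (count-⊎ _ _ _ λ a → or (ev zero a)) ⟩
    L * (count xs (ev zero) + count xs (λ a → anyF (λ c → ev (suc c) a)))
      ≡⟨ *-distribˡ-+ L _ _ ⟩
    L * count xs (ev zero) + L * count xs (λ a → anyF (λ c → ev (suc c) a))
      ≤⟨ +-mono-≤ (bound zero) (union-bound N L Y (ev ∘ suc) (bound ∘ suc)) ⟩
    Y + N * Y ∎
    where
    open ≤-Reasoning
    or : ∀ b {b′} → T (b ∨ b′) → T b ⊎ T b′
    or true  _ = inj₁ tt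
    or false t = inj₂ t

-- ok i is an event that flip i turns from false to true and that no other
-- flip affects: under the uniform measure on xs these events have
-- probability at least 1/2 and are independent.
module Independence
  (xs : List A) (ok : I → A → Bool) (flip : I → A → A) (_≟_ : DecidableEquality I)
  (flip-ok : ∀ i a → ¬ T (ok i a) → T (ok i (flip i a)))
  (flip-other : ∀ {i j} → i ≢ j → ∀ a → ok j (flip i a) ≡ ok j a)
  (flip-measure : ∀ i p → count xs (p ∘ flip i) ≡ count xs p)
  where

  agree : (Fin c → I) → A → Bool
  agree E a = allF (λ t → ok (E t) a)

  -- Where `ok e` fails, `flip e` repairs it without spoiling the other events or `Q`. So `Q₁` is
  -- covered by `Q₂` and its preimage under `flip e`, which have equal counts, and each name costs a
  -- factor of 2.
  agree-often : (E : Fin c → I) (Q : A → Bool) → (∀ t a → Q (flip (E t) a) ≡ Q a) →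
                count xs Q ≤ 2 ^ c * count xs (λ a → agree E a ∧ Q a)
  agree-often {zero}  E Q inv = ≤-reflexive (sym (+-identityʳ _))
  agree-often {suc c} E Q inv = begin
    count xs Q                            ≤⟨ agree-often (E ∘ suc) Q (inv ∘ suc) ⟩
    2 ^ c * count xs Q₁                   ≤⟨ *-monoʳ-≤ (2 ^ c) (count-⊎ xs Q₁ Q₂ (Q₂ ∘ flip e) step) ⟩
    2 ^ c * (count xs Q₂ + count xs (Q₂ ∘ flip e))
      ≡⟨ cong (λ z → 2 ^ c * (count xs Q₂ + z)) (flip-measure e Q₂) ⟩
    2 ^ c * (count xs Q₂ + count xs Q₂)   ≡⟨ double (2 ^ c) (count xs Q₂) ⟩
    2 * 2 ^ c * count xs Q₂               ∎
    where
    open ≤-Reasoning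
    e = E zero

    Q₁ Q₂ : A → Bool
    Q₁ a = agree (E ∘ suc) a ∧ Q a
    Q₂ a = agree E a ∧ Q a

    double : ∀ x y → x * (y + y) ≡ 2 * x * y
    double = solve-∀

    step : ∀ a → T (Q₁ a) → T (Q₂ a) ⊎ T (Q₂ (flip e a))
    step a t with ok e a in eq
    ... | true  = inj₁ t
    ... | false with t₁ , t₂ ← ∧⁻ {agree (E ∘ suc) a} t =
      inj₂ (∧⁺ {agree E (flip e a)} {Q (flip e a)}
              (∧⁺ (flip-ok e a (subst T eq)) (allF⁺ _ rest)) (subst T (sym (inv zero a)) t₂))
      where
      rest : ∀ s → T (ok (E (suc s)) (flip e a))
      -- `E` may repeat a name; a second occurrence of `e` is repaired by the same flip.
      rest s with E (suc s) ≟ e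
      ... | yes eq′ = subst (λ i → T (ok i (flip e a))) (sym eq′) (flip-ok e a (subst T eq))
      ... | no neq  = subst T (sym (flip-other (neq ∘ sym) a)) (allF⁻ _ t₁ s)

  none : (Fin q → Fin c → I) → A → Bool
  none Es a = allF (λ x → not (agree (Es x) a))

  Separated : (Fin q → Fin c → I) → Set
  Separated Es = ∀ {x y} → x ≢ y → ∀ s t → Es x s ≢ Es y t

  -- The factor 1 - 2⁻ᶜ is weakened to 2ᶜ / (1 + 2ᶜ), which avoids subtraction.
  none-rare : (Es : Fin q → Fin c → I) → Separated Es →
              suc (2 ^ c) ^ q * count xs (none Es) ≤ (2 ^ c) ^ q * length xs
  none-rare {zero}      Es sep = ≤-reflexive (cong (1 *_) (count-true xs))
  none-rare {suc q} {c} Es sep = begin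
    L * L ^ q * count xs (none Es)        ≡⟨ *-rotate L (L ^ q) _ ⟩
    L ^ q * (L * count xs (none Es))      ≤⟨ *-monoʳ-≤ (L ^ q) step ⟩
    L ^ q * (2 ^ c * count xs Q)          ≡⟨ *-exchange (L ^ q) (2 ^ c) _ ⟩
    2 ^ c * (L ^ q * count xs Q)          ≤⟨ *-monoʳ-≤ (2 ^ c) (none-rare (Es ∘ suc) λ x≢y → sep (x≢y ∘ Fin.suc-injective)) ⟩
    2 ^ c * ((2 ^ c) ^ q * length xs)     ≡⟨ *-assoc (2 ^ c) _ _ ⟨
    (2 ^ c) ^ suc q * length xs           ∎
    where
    open ≤-Reasoning
    L = suc (2 ^ c)

    *-rotate : ∀ x y z → x * y * z ≡ y * (x * z)
    *-rotate = solve-∀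

    Q G : A → Bool
    Q = none (Es ∘ suc)
    G = agree (Es zero)

    inv : ∀ t a → Q (flip (Es zero t) a) ≡ Q a
    inv t a = allF-cong λ x → cong not (allF-cong λ s → flip-other (sep {zero} {suc x} (λ ()) t s) a)

    step : L * count xs (none Es) ≤ 2 ^ c * count xs Q
    -- Since `Q` splits into `G′` and `N′`, and `count xs Q` is at most `2 ^ c * G′`, adding
    -- `count xs Q` to the left side gives at most `L * (G′ + N′)`.
    step = +-cancelˡ-≤ (count xs Q) _ _ (begin
      count xs Q + L * N′                      ≤⟨ +-monoˡ-≤ (L * N′) (agree-often (Es zero) Q inv) ⟩
      2 ^ c * G′ + L * N′                      ≤⟨ +-monoˡ-≤ (L * N′) (*-monoˡ-≤ G′ (n≤1+n (2 ^ c))) ⟩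
      L * G′ + L * N′                          ≡⟨ *-distribˡ-+ L G′ N′ ⟨
      L * (G′ + N′)                            ≡⟨ cong (L *_) (count-split xs Q G) ⟩
      count xs Q + 2 ^ c * count xs Q          ∎)
      where
      G′ = count xs (λ a → G a ∧ Q a)
      N′ = count xs (none Es)

-- Reorienting arcs of a tournament

∑-++ : (xs ys : List A) (g : A → ℕ) → ∑ (xs ++ ys) g ≡ ∑ xs g + ∑ ys g
∑-++ []       ys g = refl
∑-++ (x ∷ xs) ys g = trans (cong (g x +_) (∑-++ xs ys g)) (sym (+-assoc (g x) _ _))

∑-map : (f : A → B) (xs : List A) (g : B → ℕ) → ∑ (map f xs) g ≡ ∑ xs (g ∘ f)
∑-map f []       g = refl
∑-map f (x ∷ xs) g = cong (g (f x) +_) (∑-map f xs g)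

∑-product : (f : A → B → C) (xs : List A) (ys : List B) (g : C → ℕ) →
            ∑ (cartesianProductWith f xs ys) g ≡ ∑ xs (λ x → ∑ ys (g ∘ f x))
∑-product f []       ys g = refl
∑-product f (x ∷ xs) ys g = trans (∑-++ (map (f x) ys) _ g)
  (cong₂ _+_ (∑-map (f x) ys g) (∑-product f xs ys g))

-- This says that `f` permutes `xs` as a multiset, without exhibiting a bijection. The test
-- functions take values in ℕ because summing out one factor of a product leaves such a function.
record Preserves (xs : List A) (f : A → A) : Set where
  constructor mk
  field at : ∀ g → ∑ xs (g ∘ f) ≡ ∑ xs g
open Preserves

product-preserves : (c : A → B → C) {xs : List A} {ys : List B} {f : A → A} {h : B → B} {F : C → C} →
  (∀ x y → F (c x y) ≡ c (f x) (h y)) → Preserves xs f → Preserves ys h →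
  Preserves (cartesianProductWith c xs ys) F
product-preserves c {xs} {ys} {f} {h} {F} eq pf ph .at g = begin
  ∑ (cartesianProductWith c xs ys) (g ∘ F)      ≡⟨ ∑-product c xs ys (g ∘ F) ⟩
  ∑ xs (λ x → ∑ ys (λ y → g (F (c x y))))       ≡⟨ ∑-cong xs (λ x → ∑-cong ys (λ y → cong g (eq x y))) ⟩
  ∑ xs (λ x → ∑ ys (λ y → g (c (f x) (h y))))   ≡⟨ ∑-cong xs (λ x → ph .at (g ∘ c (f x))) ⟩
  ∑ xs (λ x → ∑ ys (g ∘ c (f x)))               ≡⟨ pf .at (λ x → ∑ ys (g ∘ c x)) ⟩
  ∑ xs (λ x → ∑ ys (g ∘ c x))                   ≡⟨ ∑-product c xs ys g ⟨
  ∑ (cartesianProductWith c xs ys) g            ∎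
  where open ≡-Reasoning

mapAt : (Fin m → A → A) → Vec A m → Vec A m
mapAt f v = tabulate (λ i → f i (lookup v i))

vectors-preserves : {xs : List A} → ∀ m (f : Fin m → A → A) → (∀ i → Preserves xs (f i)) →
                    Preserves (vectors xs m) (mapAt f)
vectors-preserves zero    f pf .at g = refl
vectors-preserves (suc m) f pf =
  product-preserves _∷_ (λ _ _ → refl) (pf zero) (vectors-preserves m (f ∘ suc) (pf ∘ suc))

bits-preserves : ∀ b → Preserves (true ∷ false ∷ []) (_xor b)
bits-preserves false .at g = refl
bits-preserves true  .at g = trans (cong (g false +_) (+-identityʳ _))
  (trans (+-comm (g false) (g true)) (cong (g true +_) (sym (+-identityʳ _))))

Mask : ℕ → ℕ → Set
Mask n k = Vertex n k → Vertex n k → Bool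

_⊕_ : Tournament n k → Mask n k → Tournament n k
[]      ⊕ μ = []
(M ∷ τ) ⊕ μ =
  mapAt (λ j → mapAt λ a → mapAt λ b → _xor μ (zero , a) (suc j , b)) M
  ∷ (τ ⊕ λ (i , a) (j , b) → μ (suc i , a) (suc j , b))

⊕-preserves : (μ : Mask n k) → Preserves (tournaments n k) (_⊕ μ)
⊕-preserves {n} {zero}  μ .at g = refl
⊕-preserves {n} {suc k} μ =
  product-preserves _∷_ (λ _ _ → refl)
    (vectors-preserves k _ λ j → vectors-preserves n _ λ a → vectors-preserves n _ λ b →
      bits-preserves _)
    (⊕-preserves {n} {k} _)

-- A bit is stored once, for its classes in increasing order, and read negated in the other
-- direction; symmetry of `μ` makes both readings change together.
arcs-⊕ : (τ : Tournament n k) (μ : Mask n k) → (∀ u v → μ u v ≡ μ v u) →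
         ∀ {i j} a b → i ≢ j →
         arcs (τ ⊕ μ) ((i , a) , (j , b)) ≡ arcs τ ((i , a) , (j , b)) xor μ (i , a) (j , b)
arcs-⊕ (M ∷ τ) μ sy {zero}  {zero}  a b i≢j = contradiction refl i≢j
arcs-⊕ (M ∷ τ) μ sy {zero}  {suc j} a b i≢j
  rewrite lookup∘tabulate (λ j → mapAt (λ a → mapAt λ b → _xor μ (zero , a) (suc j , b)) (lookup M j)) j
        | lookup∘tabulate (λ a → mapAt (λ b → _xor μ (zero , a) (suc j , b)) (lookup (lookup M j) a)) a
        | lookup∘tabulate (λ b → lookup (lookup (lookup M j) a) b xor μ (zero , a) (suc j , b)) b = refl
arcs-⊕ (M ∷ τ) μ sy {suc j} {zero}  b a i≢j
  rewrite lookup∘tabulate (λ j → mapAt (λ a → mapAt λ b → _xor μ (zero , a) (suc j , b)) (lookup M j)) j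
        | lookup∘tabulate (λ a → mapAt (λ b → _xor μ (zero , a) (suc j , b)) (lookup (lookup M j) a)) a
        | lookup∘tabulate (λ b → lookup (lookup (lookup M j) a) b xor μ (zero , a) (suc j , b)) b
        | sy (suc j , b) (zero , a) = Bool.not-distribˡ-xor (lookup (lookup (lookup M j) a) b) _
arcs-⊕ (M ∷ τ) μ sy {suc i} {suc j} a b i≢j = arcs-⊕ τ _ (λ _ _ → sy _ _) a b (i≢j ∘ cong suc)

Arc : ℕ → ℕ → Set
Arc n k = Vertex n k × Vertex n k

_≟ᴬ_ : DecidableEquality (Arc n k)
_≟ᴬ_ = ≡-dec (≡-dec Fin._≟_ Fin._≟_) (≡-dec Fin._≟_ Fin._≟_)

reverse : Arc n k → Tournament n k → Tournament n k
reverse e τ = τ ⊕ λ u v → does ((u , v) ≟ᴬ e) ∨ does ((v , u) ≟ᴬ e)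

Between : Arc n k → Set
Between ((i , _) , (j , _)) = i ≢ j

reverse-sym : (e : Arc n k) → ∀ u v →
  does ((u , v) ≟ᴬ e) ∨ does ((v , u) ≟ᴬ e) ≡ does ((v , u) ≟ᴬ e) ∨ does ((u , v) ≟ᴬ e)
reverse-sym e u v = Bool.∨-comm (does ((u , v) ≟ᴬ e)) _

arcs-reverse : (e : Arc n k) (τ : Tournament n k) → Between e →
               arcs (reverse e τ) e ≡ not (arcs τ e)
arcs-reverse e@((i , a) , (j , b)) τ btw = begin
  arcs (reverse e τ) e                              ≡⟨ arcs-⊕ τ _ (reverse-sym e) a b btw ⟩
  arcs τ e xor (does (e ≟ᴬ e) ∨ does (swap e ≟ᴬ e))
    ≡⟨ cong (λ z → arcs τ e xor (z ∨ does (swap e ≟ᴬ e))) (dec-true (e ≟ᴬ e) refl) ⟩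
  arcs τ e xor true                                 ≡⟨ Bool.xor-comm (arcs τ e) true ⟩
  not (arcs τ e)                                    ∎
  where open ≡-Reasoning

arcs-reverse-other : (e f : Arc n k) (τ : Tournament n k) → Between f → f ≢ e → swap f ≢ e →
                     arcs (reverse e τ) f ≡ arcs τ f
arcs-reverse-other e f@((i , a) , (j , b)) τ btw f≢e f′≢e = begin
  arcs (reverse e τ) f                              ≡⟨ arcs-⊕ τ _ (reverse-sym e) a b btw ⟩
  arcs τ f xor (does (f ≟ᴬ e) ∨ does (swap f ≟ᴬ e))
    ≡⟨ cong₂ (λ z w → arcs τ f xor (z ∨ w))
         (dec-false (f ≟ᴬ e) f≢e) (dec-false (swap f ≟ᴬ e) f′≢e) ⟩
  arcs τ f xor false                                ≡⟨ Bool.xor-identityʳ _ ⟩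
  arcs τ f                                          ∎
  where open ≡-Reasoning

-- Arcs are given by names in I; a name that is not Valid imposes no constraint.
module Orient
  {Valid : I → Set} (valid? : ∀ i → Dec (Valid i)) (_≟_ : DecidableEquality I)
  (arc : I → Arc n k) (want : I → Bool)
  (between : ∀ i → Valid i → Between (arc i))
  (distinct : ∀ {i j} → Valid i → Valid j → i ≢ j → arc j ≢ arc i × swap (arc j) ≢ arc i)
  where

  ok : I → Tournament n k → Bool
  ok i τ with valid? i
  ... | yes _ = does (arcs τ (arc i) Bool.≟ want i)
  ... | no _  = true

  flip : I → Tournament n k → Tournament n k
  flip i τ with valid? i
  ... | yes _ = reverse (arc i) τ
  ... | no _  = τ

  flip-ok : ∀ i τ → ¬ T (ok i τ) → T (ok i (flip i τ))
  flip-ok i τ ¬t with valid? i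
  ... | no _  = tt
  ... | yes v rewrite arcs-reverse (arc i) τ (between i v) with arcs τ (arc i) | want i
  ...   | true  | true  = ¬t tt
  ...   | false | false = ¬t tt
  ...   | true  | false = tt
  ...   | false | true  = tt

  flip-other : ∀ {i j} → i ≢ j → ∀ τ → ok j (flip i τ) ≡ ok j τ
  flip-other {i} {j} i≢j τ with valid? j | valid? i
  ... | no _  | _     = refl
  ... | yes _ | no _  = refl
  ... | yes w | yes v with d₁ , d₂ ← distinct v w i≢j =
    cong (λ z → does (z Bool.≟ want j)) (arcs-reverse-other (arc i) (arc j) τ (between j w) d₁ d₂)

  flip-measure : ∀ i p → count (tournaments n k) (p ∘ flip i) ≡ count (tournaments n k) p
  flip-measure i p with valid? i
  ... | yes _ = ⊕-preserves {n} {k} _ .at (𝟙 ∘ p)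
  ... | no _  = refl

  open Independence (tournaments n k) ok flip _≟_ flip-ok flip-other flip-measure public

  ok⁻ : ∀ i τ → Valid i → T (ok i τ) → arcs τ (arc i) ≡ want i
  ok⁻ i τ v t with valid? i
  ... | no ¬v = contradiction v ¬v
  ... | yes _ with yes eq ← arcs τ (arc i) Bool.≟ want i = eq

-- Oriented transversals

remQuot-injective : ∀ {m} n {x y : Fin (m * n)} → remQuot {m} n x ≡ remQuot n y → x ≡ y
remQuot-injective {m} n {x} {y} eq =
  trans (sym (Fin.combine-remQuot {m} n x)) (trans (cong (uncurry combine) eq) (Fin.combine-remQuot {m} n y))

-- Transversals of s families are selected along lines a ↦ x + a * y.  Two lines
-- agree for at most one a, so their selections involve disjoint sets of arcs.
line-≤ : ∀ x x′ a d y y′ → x + a * y ≡ x′ + a * y′ →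
         x + (a + suc d) * y ≡ x′ + (a + suc d) * y′ → y ≡ y′
line-≤ x x′ a d y y′ e₁ e₂ = *-cancelˡ-≡ y y′ (suc d) (+-cancelˡ-≡ (x + a * y) _ _ (begin
  (x + a * y) + suc d * y      ≡⟨ split x y ⟨
  x + (a + suc d) * y          ≡⟨ e₂ ⟩
  x′ + (a + suc d) * y′        ≡⟨ split x′ y′ ⟩
  (x′ + a * y′) + suc d * y′   ≡⟨ cong (_+ suc d * y′) e₁ ⟨
  (x + a * y) + suc d * y′     ∎))
  where
  open ≡-Reasoning
  split : ∀ x y → x + (a + suc d) * y ≡ (x + a * y) + suc d * y
  split x y = trans (cong (x +_) (*-distribʳ-+ y a (suc d))) (sym (+-assoc x (a * y) _))

line-injective : ∀ x x′ {a b} y y′ → a ≢ b → x + a * y ≡ x′ + a * y′ →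
                 x + b * y ≡ x′ + b * y′ → x ≡ x′ × y ≡ y′
line-injective x x′ {a} {b} y y′ a≢b e₁ e₂ =
  +-cancelʳ-≡ (a * y) x x′ (trans e₁ (cong (λ z → x′ + a * z) (sym y≡y′))) , y≡y′
  where
  y≡y′ : y ≡ y′
  y≡y′ with <-cmp a b
  ... | tri≈ _ a≡b _ = contradiction a≡b a≢b
  ... | tri< a<b _ _ with d , refl ← m≤n⇒∃[o]m+o≡n a<b =
    line-≤ x x′ a d y y′ e₁ (subst (λ c → x + c * y ≡ x′ + c * y′) (sym (+-suc a d)) e₂)
  ... | tri> _ _ b<a with d , refl ← m≤n⇒∃[o]m+o≡n b<a =
    line-≤ x x′ b d y y′ e₂ (subst (λ c → x + c * y ≡ x′ + c * y′) (sym (+-suc b d)) e₁)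

line : Fin h → Fin h → Fin s → Fin (s * h)
line {h} {s} x y a = fromℕ< (begin-strict
  toℕ x + toℕ a * toℕ y  <⟨ +-monoˡ-< (toℕ a * toℕ y) (Fin.toℕ<n x) ⟩
  h + toℕ a * toℕ y      ≤⟨ +-monoʳ-≤ h (*-monoʳ-≤ (toℕ a) (<⇒≤ (Fin.toℕ<n y))) ⟩
  suc (toℕ a) * h        ≤⟨ *-monoˡ-≤ h (Fin.toℕ<n a) ⟩
  s * h                  ∎)
  where open ≤-Reasoning

toℕ-line : (x y : Fin h) (a : Fin s) → toℕ (line x y a) ≡ toℕ x + toℕ a * toℕ y
toℕ-line x y a = Fin.toℕ-fromℕ< _

lines-meet-once : {x y x′ y′ : Fin h} {a b : Fin s} → a ≢ b →
                  line x y a ≡ line x′ y′ a → line x y b ≡ line x′ y′ b → (x , y) ≡ (x′ , y′)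
lines-meet-once {x = x} {y} {x′} {y′} {a} {b} a≢b e₁ e₂
  with p , q ← line-injective (toℕ x) (toℕ x′) (toℕ y) (toℕ y′) (a≢b ∘ Fin.toℕ-injective)
         (trans (sym (toℕ-line x y a)) (trans (cong toℕ e₁) (toℕ-line x′ y′ a)))
         (trans (sym (toℕ-line x y b)) (trans (cong toℕ e₂) (toℕ-line x′ y′ b)))
  = cong₂ _,_ (Fin.toℕ-injective p) (Fin.toℕ-injective q)

-- s families of N disjoint transversals each: R a x l is the vertex in class
-- l of the x-th transversal of family a.
Families : (n k s N : ℕ) → Set
Families n k s N = Fin s → Fin N → Fin k → Fin n

DisjointFamilies : ∀ {N} → Families n k s N → Set
DisjointFamilies R = ∀ a x b y l → R a x l ≡ R b y l → a ≡ b × x ≡ y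

-- When `ρ` is a height, no arc between two chosen transversals descends: it goes from class `l` to
-- class `l′` exactly if `ρ` increases that way.
Oriented : Tournament n k → ∀ {N} → Families n k s N → (Fin s → Fin N → Fin k → Fin b) → Set
Oriented {k = k} {s = s} τ {N} R ρ =
  Σ (Fin s → Fin N) λ f → ∀ a b (l l′ : Fin k) → a ≢ b → l Fin.< l′ →
    arcs τ ((l , R a (f a) l) , (l′ , R b (f b) l′)) ≡ does (ρ a (f a) l Fin.<? ρ b (f b) l′)

private
  _≟²_ : (p q : Fin m × Fin n) → Dec (p ≡ q)
  _≟²_ = ≡-dec Fin._≟_ Fin._≟_

module Linking (R : Families n k s (s * h)) (ρ : Fin s → Fin (s * h) → Fin k → Fin b)
               (disj : DisjointFamilies R) where

  Name : Set
  Name = (Fin h × Fin h) × (Fin s × Fin s) × (Fin k × Fin k)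

  Valid : Name → Set
  Valid (_ , (a , b) , (l , l′)) = a ≢ b × l Fin.< l′

  arc : Name → Arc n k
  arc ((x , y) , (a , b) , (l , l′)) = (l , R a (line x y a) l) , (l′ , R b (line x y b) l′)

  want : Name → Bool
  want ((x , y) , (a , b) , (l , l′)) = does (ρ a (line x y a) l Fin.<? ρ b (line x y b) l′)

  between : ∀ i → Valid i → Between (arc i)
  between _ (_ , l<l′) = Fin.<⇒≢ l<l′

  -- By disjointness an arc determines its two families and the indices of its transversals in them,
  -- which are two points of the line; as `a ≢ b`, these determine `x` and `y`.
  arc-injective : ∀ {i j} → Valid i → arc j ≡ arc i → j ≡ i
  arc-injective {(x , y) , (a , b) , (l , l′)} {(x′ , y′) , (a′ , b′) , (m , m′)} (a≢b , _) eq
    with refl ← cong (proj₁ ∘ proj₁) eq | refl ← cong (proj₁ ∘ proj₂) eq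
    with refl , e₁ ← disj _ _ _ _ _ (,-injectiveʳ (cong proj₁ eq))
       | refl , e₂ ← disj _ _ _ _ _ (,-injectiveʳ (cong proj₂ eq))
    = cong (_, (a , b) , (l , l′)) (lines-meet-once a≢b e₁ e₂)
  distinct : ∀ {i j} → Valid i → Valid j → i ≢ j → arc j ≢ arc i × swap (arc j) ≢ arc i
  distinct v@(_ , p) (_ , q) i≢j = (λ eq → i≢j (sym (arc-injective v eq))) ,
    λ eq → <-asym p (subst₂ _<_ (cong (toℕ ∘ proj₁ ∘ proj₂) eq) (cong (toℕ ∘ proj₁ ∘ proj₁) eq) q)

  open Orient {Valid = Valid} (λ (_ , (a , b) , (l , l′)) → ¬? (a Fin.≟ b) ×-dec (l Fin.<? l′))
    (≡-dec _≟²_ (≡-dec _≟²_ _≟²_)) arc want between distinct public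

  -- One block per line `(x , y)`, running through all pairs of families and of classes; the pairs
  -- with equal families or non-increasing classes are not `Valid` and cost nothing but a larger
  -- constant.
  blocks : Fin (h * h) → Fin ((s * s) * (k * k)) → Name
  blocks q t with ab , ll ← remQuot {s * s} (k * k) t = remQuot {h} h q , remQuot s ab , remQuot k ll

  separated : Separated blocks
  separated x≢y s t eq = x≢y (remQuot-injective h (cong proj₁ eq))

  found : ∀ τ → ¬ T (none blocks τ) → Oriented τ R ρ
  found τ ¬none with q , ¬¬agree ← ¬allF⁻ _ ¬none = uncurry line (remQuot {h} h q) , hit
    where
    all-ok : ∀ t → T (ok (blocks q t) τ)
    all-ok = allF⁻ _ (¬not⁻ ¬¬agree)
    hit : ∀ a b l l′ → a ≢ b → l Fin.< l′ → arcs τ (arc (remQuot {h} h q , (a , b) , (l , l′))) ≡ _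
    hit a b l l′ a≢b l<l′ = ok⁻ (remQuot {h} h q , (a , b) , (l , l′)) τ (a≢b , l<l′)
      (subst (λ i → T (ok i τ)) eq (all-ok slot))
      where
      slot = combine (combine a b) (combine l l′)
      eq : blocks q slot ≡ (remQuot {h} h q , (a , b) , (l , l′))
      eq = cong (remQuot {h} h q ,_) (trans
        (cong (λ p → remQuot {s} s (proj₁ p) , remQuot {k} k (proj₂ p))
          (Fin.remQuot-combine {s * s} {k * k} (combine a b) (combine l l′)))
        (cong₂ _,_ (Fin.remQuot-combine a b) (Fin.remQuot-combine l l′)))

linkC : ℕ → ℕ → ℕ
linkC k s = (s * s) * (k * k)

module _ (R : Families n k s (s * h)) (ρ : Fin s → Fin (s * h) → Fin k → Fin b) where

  disjointFamilies? : Dec (DisjointFamilies R)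
  disjointFamilies? = Fin.all? λ a → Fin.all? λ x → Fin.all? λ b → Fin.all? λ y → Fin.all? λ l →
    (R a x l Fin.≟ R b y l) →-dec (a Fin.≟ b) ×-dec (x Fin.≟ y)

  -- The event is empty when the families are not disjoint, so that the union bound can range over
  -- all codes.
  unlinked : Tournament n k → Bool
  unlinked with disjointFamilies?
  ... | yes disj = Linking.none {h = h} R ρ disj (Linking.blocks {h = h} R ρ disj)
  ... | no _     = λ _ → false

  unlinked-rare : suc (2 ^ linkC k s) ^ (h * h) * count (tournaments n k) unlinked ≤
                  (2 ^ linkC k s) ^ (h * h) * length (tournaments n k)
  unlinked-rare with disjointFamilies?
  ... | yes disj = none-rare blocks separated
    where open Linking {h = h} R ρ disj
  ... | no _     = never-rare (tournaments n k) (suc (2 ^ linkC k s) ^ (h * h))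

  ¬unlinked⇒linked : DisjointFamilies R → ∀ τ → ¬ T (unlinked τ) → Oriented τ R ρ
  ¬unlinked⇒linked disj′ τ ¬u with disjointFamilies?
  ... | yes disj = Linking.found {h = h} R ρ disj τ ¬u
  ... | no ¬disj = contradiction disj′ ¬disj

module _ (n k s h b : ℕ) where

  private
    Slots = s * (s * h) * k

  -- A code records the heights of the vertices of the families only, so that
  -- there are 2 ^ O(h log n) codes, against a failure probability 2 ^ -Ω(h²).
  decode : Fin ((n * b) ^ Slots) → Fin s → Fin (s * h) → Fin k → Fin n × Fin b
  decode c a x l = remQuot b (finToFun c (combine (combine a x) l))

  private
    value : (Fin s → Fin (s * h) → Fin k → Fin n × Fin b) → Fin (s * (s * h)) × Fin k → Fin (n * b)
    value f (ax , l) = uncurry combine (uncurry f (remQuot {s} (s * h) ax) l)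

  encode : (Fin s → Fin (s * h) → Fin k → Fin n × Fin b) → Fin ((n * b) ^ Slots)
  encode f = funToFin λ i → value f (remQuot {s * (s * h)} k i)

  decode-encode : ∀ f a x l → decode (encode f) a x l ≡ f a x l
  decode-encode f a x l = begin
    remQuot b (finToFun (encode f) (combine (combine a x) l))
      ≡⟨ cong (remQuot b) (Fin.finToFun-funToFin _ (combine (combine a x) l)) ⟩
    remQuot b (value f (remQuot {s * (s * h)} k (combine (combine a x) l)))
      ≡⟨ cong (remQuot b ∘ value f) (Fin.remQuot-combine (combine a x) l) ⟩
    remQuot b (uncurry combine (uncurry f (remQuot {s} (s * h) (combine a x)) l))
      ≡⟨ cong (λ p → remQuot b (uncurry combine (uncurry f p l))) (Fin.remQuot-combine a x) ⟩
    remQuot b (uncurry combine (f a x l))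
      ≡⟨ Fin.remQuot-combine (proj₁ (f a x l)) (proj₂ (f a x l)) ⟩
    f a x l ∎
    where open ≡-Reasoning

  private
    fails : Fin ((n * b) ^ Slots) → Tournament n k → Bool
    fails c = unlinked {h = h} (λ a x l → proj₁ (decode c a x l)) (λ a x l → proj₂ (decode c a x l))

  linking-fails : Tournament n k → Bool
  linking-fails τ = anyF λ c → fails c τ

  linking-fails-rare : suc (2 ^ linkC k s) ^ (h * h) * count (tournaments n k) linking-fails ≤
    (n * b) ^ Slots * ((2 ^ linkC k s) ^ (h * h) * length (tournaments n k))
  linking-fails-rare = union-bound (tournaments n k) _ (suc (2 ^ linkC k s) ^ (h * h)) _ fails λ c →
    unlinked-rare {h = h} (λ a x l → proj₁ (decode c a x l)) (λ a x l → proj₂ (decode c a x l))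

  -- Failure is excluded for decoded functions only, so the selection is found for the decoding of
  -- the code of `R` and `ρ` and carried back pointwise.
  linking : ∀ τ → ¬ T (linking-fails τ) → (R : Families n k s (s * h)) (ρ : Fin s → Fin (s * h) → Fin k → Fin b) →
            DisjointFamilies R → Oriented τ R ρ
  linking τ ¬fails R ρ disj = f , λ a b l l′ a≢b l<l′ →
    subst₂ (λ p q → arcs τ ((l , proj₁ p) , (l′ , proj₁ q)) ≡ does (proj₂ p Fin.<? proj₂ q))
      (decode-encode Rρ a (f a) l) (decode-encode Rρ b (f b) l′) (linked a b l l′ a≢b l<l′)
    where
    Rρ : Fin s → Fin (s * h) → Fin k → Fin n × Fin b
    Rρ a x l = R a x l , ρ a x l

    R′ : Families n k s (s * h)
    R′ a x l = proj₁ (decode (encode Rρ) a x l)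

    ρ′ : Fin s → Fin (s * h) → Fin k → Fin b
    ρ′ a x l = proj₂ (decode (encode Rρ) a x l)

    disj′ : DisjointFamilies R′
    disj′ a x b y l eq = disj a x b y l
      (trans (sym (cong proj₁ (decode-encode Rρ a x l))) (trans eq (cong proj₁ (decode-encode Rρ b y l))))

    linkedness : Oriented τ R′ ρ′
    linkedness = ¬unlinked⇒linked {h = h} R′ ρ′ disj′ τ
      (λ t → ¬fails (anyF⁺ (λ c → fails c τ) (encode Rρ) t))
    f = proj₁ linkedness
    linked = proj₂ linkedness

-- Many 4-cycles through two vertices of a class

module Alternation (n k w h : ℕ) (room : 2 * (w * h) ≤ n) where

  -- The first `2 * (w * h)` vertices of a class are arranged in `w` groups of `h` pairs. Pairs of
  -- one group give independent chances of a 4-cycle, and distinct groups give distinct vertices.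
  slot : Fin 2 → Fin w → Fin h → Fin n
  slot e g x = inject≤ (combine e (combine g x)) room

  slot-injective : ∀ {e g x e′ g′ x′} → slot e g x ≡ slot e′ g′ x′ → e ≡ e′ × g ≡ g′ × x ≡ x′
  slot-injective {e} {g} {x} {e′} {g′} {x′} eq
    with refl , eq′ ← Fin.combine-injective e (combine g x) e′ (combine g′ x′)
                        (Fin.inject≤-injective room room _ _ eq)
    with p , q ← Fin.combine-injective g x g′ x′ eq′ = refl , p , q

  -- The 4-cycle u → slot 0 g x → u′ → slot 1 g x → u.
  FourCycle : Tournament n k → Fin k → Fin k → Fin n → Fin n → Fin w → Fin h → Set
  FourCycle τ i j u u′ g x =
    arcs τ ((i , u) , (j , slot zero g x)) ≡ true ×
    arcs τ ((i , u′) , (j , slot zero g x)) ≡ false ×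
    arcs τ ((i , u) , (j , slot (suc zero) g x)) ≡ false ×
    arcs τ ((i , u′) , (j , slot (suc zero) g x)) ≡ true

  module _ (i j : Fin k) (u u′ : Fin n) (g : Fin w) where

    module Group (i≢j : i ≢ j) (u≢u′ : u ≢ u′) where

      Name : Set
      Name = Fin h × Fin 2 × Fin 2

      centre : Fin 2 → Fin n
      centre zero    = u
      centre (suc _) = u′

      centre-injective : ∀ {d d′} → centre d ≡ centre d′ → d ≡ d′
      centre-injective {zero}     {zero}     eq = refl
      centre-injective {zero}     {suc zero} eq = contradiction eq u≢u′
      centre-injective {suc zero} {zero}     eq = contradiction (sym eq) u≢u′
      centre-injective {suc zero} {suc zero} eq = refl

      arc : Name → Arc n k
      arc (x , e , d) = (i , centre d) , (j , slot e g x)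

      arc-injective : ∀ {a b} → arc a ≡ arc b → a ≡ b
      arc-injective {x , e , d} {x′ , e′ , d′} eq
        with refl ← centre-injective {d} {d′} (,-injectiveʳ (,-injectiveˡ eq))
           | refl , _ , refl ← slot-injective {e} {g} {x} {e′} {g} {x′} (,-injectiveʳ (,-injectiveʳ eq)) = refl

      open Orient {Valid = λ _ → ⊤} (λ _ → yes tt) (≡-dec Fin._≟_ (≡-dec Fin._≟_ Fin._≟_))
        -- In the 4-cycle `u` precedes slot 0 and `u′` precedes slot 1, so the arc leaves the centre
        -- exactly when the two indices agree.
        arc (λ (x , e , d) → does (e Fin.≟ d)) (λ _ _ → i≢j)
        (λ _ _ a≢b → (λ eq → a≢b (sym (arc-injective eq))) ,
                      (λ eq → i≢j (sym (cong (proj₁ ∘ proj₁) eq)))) public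

      blocks : Fin h → Fin 4 → Name
      blocks x t = x , remQuot 2 t

      found : ∀ τ → ¬ T (none blocks τ) → ∃ (FourCycle τ i j u u′ g)
      found τ ¬none with x , ¬¬agree ← ¬allF⁻ _ ¬none =
        x , hit 0F , hit 1F , hit 2F , hit 3F
        where
        hit : ∀ t → arcs τ (arc (blocks x t)) ≡ does (proj₁ (remQuot {2} 2 t) Fin.≟ proj₂ (remQuot {2} 2 t))
        hit t = ok⁻ (blocks x t) τ tt (allF⁻ (λ t → ok (blocks x t) τ) (¬not⁻ ¬¬agree) t)

    distinct? : Dec (i ≢ j × u ≢ u′)
    distinct? = ¬? (i Fin.≟ j) ×-dec ¬? (u Fin.≟ u′)

    no-cycle : Tournament n k → Bool
    no-cycle with distinct?
    ... | yes (i≢j , u≢u′) = Group.none i≢j u≢u′ (Group.blocks i≢j u≢u′)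
    ... | no _             = λ _ → false

    -- A 4-cycle prescribes four arcs, whence `2 ^ 4 = 16`, and the `h` pairs of the group use
    -- disjoint sets of arcs.
    no-cycle-rare : 17 ^ h * count (tournaments n k) no-cycle ≤ 16 ^ h * length (tournaments n k)
    no-cycle-rare with distinct?
    ... | yes (i≢j , u≢u′) = none-rare blocks (λ x≢y _ _ → x≢y ∘ cong proj₁)
      where open Group i≢j u≢u′
    ... | no _ = never-rare (tournaments n k) (17 ^ h)

    ¬no-cycle⇒cycle : i ≢ j → u ≢ u′ → ∀ τ → ¬ T (no-cycle τ) → ∃ (FourCycle τ i j u u′ g)
    ¬no-cycle⇒cycle i≢j u≢u′ τ ¬t with distinct?
    ... | yes (p , q) = Group.found p q τ ¬t
    ... | no ¬d       = contradiction (i≢j , u≢u′) ¬d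

  private
    Codes = (k * k) * ((n * n) * w)

    Places = (Fin k × Fin k) × (Fin n × Fin n) × Fin w

    placesOf : Fin Codes → Places
    placesOf c =
      let ij , uug = remQuot {k * k} ((n * n) * w) c ; uu , g = remQuot {n * n} w uug
      in remQuot k ij , remQuot n uu , g

    codeOf : Places → Fin Codes
    codeOf ((i , j) , (u , u′) , g) = combine (combine i j) (combine (combine u u′) g)

    placesOf-codeOf : ∀ p → placesOf (codeOf p) ≡ p
    placesOf-codeOf ((i , j) , (u , u′) , g)
      with e ← Fin.remQuot-combine {k * k} {(n * n) * w} (combine i j) (combine (combine u u′) g)
         | e′ ← Fin.remQuot-combine {n * n} {w} (combine u u′) g =
      cong₂ _,_ (trans (cong (remQuot k ∘ proj₁) e) (Fin.remQuot-combine i j))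
        (cong₂ _,_
          (trans (cong (remQuot n ∘ proj₁ ∘ remQuot {n * n} w ∘ proj₂) e)
            (trans (cong (remQuot n ∘ proj₁) e′) (Fin.remQuot-combine u u′)))
          (trans (cong (proj₂ ∘ remQuot {n * n} w ∘ proj₂) e) (cong proj₂ e′)))

    fails : Places → Tournament n k → Bool
    fails ((i , j) , (u , u′) , g) = no-cycle i j u u′ g

  alternation-fails : Tournament n k → Bool
  alternation-fails τ = anyF λ c → fails (placesOf c) τ

  alternation-fails-rare : 17 ^ h * count (tournaments n k) alternation-fails ≤
                           Codes * (16 ^ h * length (tournaments n k))
  alternation-fails-rare = union-bound (tournaments n k) _ (17 ^ h) _ (fails ∘ placesOf)
    λ c → let (i , j) , (u , u′) , g = placesOf c in no-cycle-rare i j u u′ g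

  alternation : ∀ τ → ¬ T (alternation-fails τ) → ∀ {i j u u′} → i ≢ j → u ≢ u′ → ∀ g →
                ∃ (FourCycle τ i j u u′ g)
  alternation τ ¬fails {i} {j} {u} {u′} i≢j u≢u′ g = ¬no-cycle⇒cycle i j u u′ g i≢j u≢u′ τ λ t →
    ¬fails (anyF⁺ _ (codeOf p) (subst (λ q → T (fails q τ)) (sym (placesOf-codeOf p)) t))
    where
    p : Places
    p = (i , j) , (u , u′) , g

-- Heights in an acyclic digraph

tally : (ℕ → Bool) → ℕ → ℕ
tally f zero    = 0
tally f (suc m) = 𝟙 (f m) + tally f m

𝟙≤1 : ∀ b → 𝟙 b ≤ 1
𝟙≤1 true  = s≤s z≤n
𝟙≤1 false = z≤n

𝟙-mono : ∀ {b c} → (T b → T c) → 𝟙 b ≤ 𝟙 c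
𝟙-mono {false}         f = z≤n
𝟙-mono {true}  {true}  f = s≤s z≤n
𝟙-mono {true}  {false} f = ⊥-elim (f tt)

tally-≤ : ∀ f m → tally f m ≤ m
tally-≤ f zero    = z≤n
tally-≤ f (suc m) = +-mono-≤ (𝟙≤1 (f m)) (tally-≤ f m)

tally-mono : ∀ {f g} → (∀ t → T (f t) → T (g t)) → ∀ m → tally f m ≤ tally g m
tally-mono f⇒g zero    = z≤n
tally-mono f⇒g (suc m) = +-mono-≤ (𝟙-mono (f⇒g m)) (tally-mono f⇒g m)

tally-shift : ∀ f m → tally f (suc m) ≡ 𝟙 (f 0) + tally (f ∘ suc) m
tally-shift f zero    = refl
tally-shift f (suc m) = begin
  𝟙 (f (suc m)) + tally f (suc m)                      ≡⟨ cong (𝟙 (f (suc m)) +_) (tally-shift f m) ⟩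
  𝟙 (f (suc m)) + (𝟙 (f 0) + tally (f ∘ suc) m)        ≡⟨ +-assoc (𝟙 (f (suc m))) _ _ ⟨
  𝟙 (f (suc m)) + 𝟙 (f 0) + tally (f ∘ suc) m          ≡⟨ cong (_+ tally (f ∘ suc) m) (+-comm (𝟙 (f (suc m))) (𝟙 (f 0))) ⟩
  𝟙 (f 0) + 𝟙 (f (suc m)) + tally (f ∘ suc) m          ≡⟨ +-assoc (𝟙 (f 0)) _ _ ⟩
  𝟙 (f 0) + tally (f ∘ suc) (suc m)                    ∎
  where open ≡-Reasoning

module Height {M : ℕ} {V : Set} (e : Fin M ↔ V) (D F : ArcSet V) (fas : IsFeedbackArcSet D F) where

  open Inverse e using (to; from; strictlyInverseˡ)

  _⇝_ : V → V → Bool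
  u ⇝ v = D (u , v) ∧ not (F (u , v))

  _→ᶠ_ : V → V → Set
  u →ᶠ v = T (u ⇝ v)

  Closed : Set
  Closed = ∃[ m ] Σ[ c ∈ Vec V (suc m) ] Unique c × All (λ (u , v) → u →ᶠ v) (closedWalk c)

  -- The walk is cut just before `x`. The predecessor `p` is kept general because it moves along in
  -- the induction; taking `p = x` yields a closed walk through `x ∷ zs`. The last component passes
  -- properties of the walk on to `zs`.
  prefix : ∀ {x p y} {ys : Vec V m} → p →ᶠ y → Linked _→ᶠ_ (y ∷ ys) → Unique (y ∷ ys) → x ∈ (y ∷ ys) →
    ∃[ l ] Σ[ zs ∈ Vec V l ] Unique zs × All (x ≢_) zs ×
      All (λ (u , v) → u →ᶠ v) (zip (p ∷ zs) (zs ∷ʳ x)) ×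
      (∀ {P : V → Set} → All P (y ∷ ys) → All P zs)
  prefix p→y _ _ (here refl) = 0 , [] , [] , [] , p→y ∷ [] , λ _ → []
  prefix {x = x} {y = y} {ys = _ ∷ _} p→y (y→z ∷ linked) (y∉ ∷ unique) (there x∈)
    with l , zs , uzs , x∉zs , walk , sub ← prefix y→z linked unique x∈ =
    suc l , y ∷ zs , sub y∉ ∷ uzs , (λ { refl → All.lookup y∉ x∈ refl }) ∷ x∉zs , p→y ∷ walk ,
    λ { (py ∷ pys) → py ∷ sub pys }

  _≟ⱽ_ : (x y : V) → Dec (x ≡ y)
  x ≟ⱽ y with from x Fin.≟ from y
  ... | yes eq = yes (trans (sym (strictlyInverseˡ x)) (trans (cong to eq) (strictlyInverseˡ y)))
  ... | no neq = no (neq ∘ cong from)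

  unique-or-closed : (xs : Vec V m) → Linked _→ᶠ_ xs → Unique xs ⊎ Closed
  unique-or-closed []       _   = inj₁ []
  unique-or-closed (x ∷ []) [-] = inj₁ ([] ∷ [])
  unique-or-closed (x ∷ xs@(_ ∷ _)) (x→y ∷ linked) with unique-or-closed xs linked
  ... | inj₂ closed = inj₂ closed
  ... | inj₁ unique with Any.any? (x ≟ⱽ_) xs
  ...   | no x∉ = inj₁ (All.lookup⁻ (λ i eq → x∉ (subst (_∈ xs) (sym eq) (∈-lookup i xs))) ∷ unique)
  ...   | yes x∈ with l , zs , uzs , x∉zs , walk , _ ← prefix x→y linked unique x∈ =
    inj₂ (l , x ∷ zs , x∉zs ∷ uzs , walk)

  no-closed : ¬ Closed
  no-closed (m , c , unique , walk) = absurd walk (proj₂ fas c (unique , All.map (λ {(u , v)} → in-D u v) walk))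
    where
    in-D : ∀ u v → u →ᶠ v → T (D (u , v))
    in-D u v t with D (u , v)
    ... | true = tt

    not-F : ∀ u v → u →ᶠ v → ¬ T (F (u , v))
    not-F u v t f with D (u , v) | F (u , v)
    ... | true | true = t

    absurd : ∀ {l} {as : Vec _ l} → All (λ (u , v) → u →ᶠ v) as → ¬ Any ⟦ F ⟧ as
    absurd (p ∷ _)  (here f)  = not-F _ _ p f
    absurd (_ ∷ ps) (there a) = absurd ps a

  walk : ℕ → V → Bool
  walk zero    u = true
  walk (suc t) u = anyF λ x → (u ⇝ to x) ∧ walk t (to x)

  walk⁻ : ∀ t u → T (walk t u) → Σ[ xs ∈ Vec V t ] Linked _→ᶠ_ (u ∷ xs)
  walk⁻ zero    u _ = [] , [-]
  walk⁻ (suc t) u w with x , a ← anyF⁻ (λ x → (u ⇝ to x) ∧ walk t (to x)) w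
    with p , q ← ∧⁻ {u ⇝ to x} a with xs , linked ← walk⁻ t (to x) q = to x ∷ xs , p ∷ linked

  walk⁺ : ∀ {u v} t → u →ᶠ v → T (walk t v) → T (walk (suc t) u)
  walk⁺ {u} {v} t u→v w = anyF⁺ (λ x → (u ⇝ to x) ∧ walk t (to x)) (from v)
    (subst (λ z → T ((u ⇝ z) ∧ walk t z)) (sym (strictlyInverseˡ v)) (∧⁺ u→v w))

  -- A walk of length `M` visits `M + 1` vertices, so it repeats one and contains a cycle that
  -- avoids `F`.
  no-long-walk : ∀ u → walk M u ≡ false
  no-long-walk u with walk M u in eq
  ... | false = refl
  ... | true with xs , linked ← walk⁻ M u (subst T (sym eq) tt) with unique-or-closed (u ∷ xs) linked
  ...   | inj₂ closed = contradiction closed no-closed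
  ...   | inj₁ unique = contradiction (Fin.injective⇒≤ {f = from ∘ lookup (u ∷ xs)} inj) (<⇒≱ ≤-refl)
    where
    inj : ∀ {i j} → from (lookup (u ∷ xs) i) ≡ from (lookup (u ∷ xs) j) → i ≡ j
    inj eq′ = Unique.lookup-injective unique _ _
      (trans (sym (strictlyInverseˡ _)) (trans (cong to eq′) (strictlyInverseˡ _)))

  -- Initial segments of walks are walks, so the number of lengths below `M` that occur is one more
  -- than the length of a longest walk from `u`. Counting lengths allows heights to be compared
  -- termwise.
  height : V → Fin (suc M)
  height u = fromℕ< (s≤s (tally-≤ (λ t → walk t u) M))

  -- Prepending `u` turns a walk of length `t` from `v` into one of length `t + 1` from `u`. The
  -- empty walk at `u` makes the inequality strict, and nothing is lost at length `M` because no
  -- such walk exists.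
  height-drops : ∀ {u v} → T (D (u , v)) → ¬ T (F (u , v)) → height v Fin.< height u
  height-drops {u} {v} d ¬f = subst₂ _<_ (sym (Fin.toℕ-fromℕ< _)) (sym (Fin.toℕ-fromℕ< _)) (begin
    suc (tally (λ t → walk t v) M)          ≤⟨ s≤s (tally-mono (λ t → walk⁺ t u→v) M) ⟩
    suc (tally (λ t → walk (suc t) u) M)    ≡⟨ tally-shift (λ t → walk t u) M ⟨
    tally (λ t → walk t u) (suc M)          ≡⟨ cong (λ b → 𝟙 b + tally (λ t → walk t u) M) (no-long-walk u) ⟩
    tally (λ t → walk t u) M                ∎)
    where
    open ≤-Reasoning
    u→v : u →ᶠ v
    u→v with D (u , v) | F (u , v)
    ... | true | true  = ¬f tt
    ... | true | false = tt

-- Extending a packing of cliques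

Inj : {A B : Set} → (A → B) → Set
Inj f = ∀ {x y} → f x ≡ f y → x ≡ y

record Complement (f : Fin m → Fin n) (d : ℕ) : Set where
  field
    free      : Fin d → Fin n
    injective : Inj free
    avoids    : ∀ i j → f i ≢ free j
    covers    : ∀ v → (∃[ i ] f i ≡ v) ⊎ (∃[ j ] free j ≡ v)

complement : (f : Fin m → Fin n) → Inj f → m + d ≡ n → Complement f d
complement {zero}  f inj refl = record
  { free = id ; injective = id ; avoids = λ () ; covers = λ v → inj₂ (v , refl) }
complement {suc m} {suc n} {d} f inj eq = record
  { free      = punchIn p ∘ free
  ; injective = injective ∘ Fin.punchIn-injective p _ _
  ; avoids    = avoids′
  ; covers    = covers′
  }
  where
  p = f zero

  p≢ : ∀ i → p ≢ f (suc i)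
  p≢ i e with () ← inj e

  f′ : Fin m → Fin n
  f′ i = punchOut (p≢ i)

  open Complement (complement f′ (Fin.suc-injective ∘ inj ∘ Fin.punchOut-injective (p≢ _) (p≢ _)) (suc-injective eq))

  avoids′ : ∀ i j → f i ≢ punchIn p (free j)
  avoids′ zero    j e = Fin.punchInᵢ≢i p (free j) (sym e)
  avoids′ (suc i) j e = avoids i j (Fin.punchIn-injective p _ _ (trans (Fin.punchIn-punchOut (p≢ i)) e))

  covers′ : ∀ v → (∃[ i ] f i ≡ v) ⊎ (∃[ j ] punchIn p (free j) ≡ v)
  covers′ v with p Fin.≟ v
  ... | yes p≡v = inj₁ (zero , p≡v)
  ... | no p≢v with covers (punchOut p≢v)
  ...   | inj₁ (i , e) = inj₁ (suc i , Fin.punchOut-injective (p≢ i) p≢v e)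
  ...   | inj₂ (j , e) = inj₂ (j , trans (cong (punchIn p) e) (Fin.punchIn-punchOut p≢v))

fresh : (g : Fin m → Fin n) → Inj g → (used : Fin t → Fin n) → t < m → ∃[ y ] ∀ z → used z ≢ g y
fresh {m} {n} {t} g inj used t<m with Fin.any? (λ y → Fin.all? λ z → ¬? (used z Fin.≟ g y))
... | yes found = found
... | no ¬found = contradiction (Fin.injective⇒≤ {f = proj₁ ∘ hit} hit-injective) (<⇒≱ t<m)
  where
  hit : ∀ y → ∃[ z ] used z ≡ g y
  hit y with Fin.any? (λ z → used z Fin.≟ g y)
  ... | yes h = h
  ... | no ¬h = contradiction (y , λ z e → ¬h (z , e)) ¬found

  hit-injective : ∀ {y y′} → proj₁ (hit y) ≡ proj₁ (hit y′) → y ≡ y′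
  hit-injective {y} {y′} e = inj (trans (sym (proj₂ (hit y))) (trans (cong used e) (proj₂ (hit y′))))

-- Of the first two candidates one satisfies `P`; it is kept, and the recursion continues with the
-- others.
all-but-one : {P : A → Set} (cand : Fin (suc t) → A) → Inj cand → (∀ {x y} → x ≢ y → P x ⊎ P y) →
              Σ[ e ∈ (Fin t → Fin (suc t)) ] Inj e × (∀ c → P (cand (e c)))
all-but-one {t = zero}          cand inj one = (λ ()) , (λ { {()} }) , λ ()
all-but-one {A} {suc t} {P = P} cand inj one = [ keep zero , keep (suc zero) ]′ (one λ e → 0≢1 (inj e))
  where
  0≢1 : zero ≢ suc {suc t} zero
  0≢1 ()

  keep : ∀ v → P (cand v) → Σ[ e ∈ (Fin (suc t) → Fin (suc (suc t))) ] Inj e × (∀ c → P (cand (e c)))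
  keep v Pv with e , e-inj , Pe ← all-but-one (cand ∘ punchIn v) (Fin.punchIn-injective v _ _ ∘ inj) one =
    e′ , e′-inj , λ { zero → Pv ; (suc c) → Pe c }
    where
    e′ : Fin (suc t) → Fin (suc (suc t))
    e′ zero    = v
    e′ (suc c) = punchIn v (e c)

    e′-inj : Inj e′
    e′-inj {zero}  {zero}  _  = refl
    e′-inj {zero}  {suc c} eq = contradiction (sym eq) (Fin.punchInᵢ≢i v _)
    e′-inj {suc c} {zero}  eq = contradiction eq (Fin.punchInᵢ≢i v _)
    e′-inj {suc c} {suc c′} eq = cong suc (e-inj (Fin.punchIn-injective v _ _ eq))

-- Each of the `t` conditions rules out at most one of the `t + 1` candidates.
select : (cand : Fin (suc t) → A) → Inj cand → (P : A → Fin t → Set) →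
         (∀ {x y} j → x ≢ y → P x j ⊎ P y j) → ∃[ c ] ∀ j → P (cand c) j
select {zero}  cand inj P one = zero , λ ()
select {suc t} cand inj P one with e , e-inj , Pe ← all-but-one {P = λ x → P x zero} cand inj (one zero)
  with c , Pc ← select (cand ∘ e) (e-inj ∘ inj) (λ x → P x ∘ suc) (λ j → one (suc j)) =
  e c , λ { zero → Pe c ; (suc j) → Pc j }

-- There are `k - 1` conditions, one for each index other than `i`, so `k` candidates are enough.
-- This is the source of the `k` in `n - k + 1`.
select-other : (cand : Fin k → A) → Inj cand → (i : Fin k) (P : A → Fin k → Set) →
               (∀ {x y j} → i ≢ j → x ≢ y → P x j ⊎ P y j) → ∃[ c ] ∀ {j} → i ≢ j → P (cand c) j
select-other {suc k} cand inj i P one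
  with c , Pc ← select cand inj (λ x → P x ∘ punchIn i) (λ j → one (Fin.punchInᵢ≢i i j ∘ sym)) =
  c , λ i≢j → subst (P (cand c)) (Fin.punchIn-punchOut i≢j) (Pc (punchOut i≢j))

module Packings (n k : ℕ) (_~_ : Vertex n k → Vertex n k → Set) (~-sym : ∀ {u v} → u ~ v → v ~ u) where

  record Packing (m : ℕ) : Set where
    field
      row       : Fin m → Fin k → Fin n
      injective : ∀ l {p q} → row p l ≡ row q l → p ≡ q
      clique    : ∀ p {l l′} → l ≢ l′ → (l , row p l) ~ (l′ , row p l′)

  empty : Packing 0
  empty = record { row = λ () ; injective = λ { l {()} } ; clique = λ () }

  -- Mutually joined rows R i j are exchanged as follows.  For i ≢ j, row R i j
  -- trades its vertex in class j for that of R i i.  Row R i i thereby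
  -- becomes the neighbours R i j j of u i, and takes u i in class i.  The
  -- vertices R l l l are released, and form the new clique.
  module Exchange
    (Q : Packing m) (u : Fin k → Fin n) (u-free : ∀ l p → Packing.row Q p l ≢ u l)
    (R : Fin k → Fin k → Fin m) (R-injective : ∀ {i j i′ j′} → R i j ≡ R i′ j′ → (i , j) ≡ (i′ , j′))
    (u~R : ∀ {i j} → i ≢ j → (i , u i) ~ (j , Packing.row Q (R i j) j))
    (R~R : ∀ {i j i′ j′ l l′} → (i , j) ≢ (i′ , j′) → l ≢ l′ →
           (l , Packing.row Q (R i j) l) ~ (l′ , Packing.row Q (R i′ j′) l′))
    where

    open Packing Q

    -- nothing stands for the new row, which initially holds the u l.
    Place : Set
    Place = Maybe (Fin k × Fin k)

    -- After the exchange, place `x` holds in class `l` the vertex that place `σ l x` held there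
    -- before. Each `σ l` is an involution, so in every class the vertices are merely permuted and
    -- the rows stay disjoint.
    σ : Fin k → Place → Place
    σ l nothing = just (l , l)
    σ l (just (i , j)) with i Fin.≟ j | i Fin.≟ l | j Fin.≟ l
    ... | yes _ | yes _ | _     = nothing
    ... | yes _ | no _  | _     = just (i , l)
    ... | no _  | _     | yes _ = just (i , i)
    ... | no _  | _     | no _  = just (i , j)

    σ-involutive : ∀ l x → σ l (σ l x) ≡ x
    σ-involutive l nothing with l Fin.≟ l
    ... | yes _ = refl
    ... | no l≢ = contradiction refl l≢
    σ-involutive l (just (i , j)) with i Fin.≟ j | i Fin.≟ l | j Fin.≟ l
    ... | yes refl | yes refl | _ = refl
    ... | yes refl | no i≢l | _ with i Fin.≟ l | l Fin.≟ l
    ...   | yes i≡l | _     = contradiction i≡l i≢l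
    ...   | no _    | no l≢ = contradiction refl l≢
    ...   | no _    | yes _ = refl
    σ-involutive l (just (i , j)) | no i≢j | _ | yes refl with i Fin.≟ i | i Fin.≟ l
    ...   | no i≢ | _       = contradiction refl i≢
    ...   | yes _ | yes i≡l = contradiction i≡l i≢j
    ...   | yes _ | no _    = refl
    σ-involutive l (just (i , j)) | no i≢j | _ | no j≢l with i Fin.≟ j | i Fin.≟ l | j Fin.≟ l
    ...   | yes i≡j | _ | _       = contradiction i≡j i≢j
    ...   | no _    | _ | yes j≡l = contradiction j≡l j≢l
    ...   | no _    | _ | no _    = refl

    σ-injective : ∀ l → Inj (σ l)
    σ-injective l {x} {y} eq = trans (sym (σ-involutive l x)) (trans (cong (σ l) eq) (σ-involutive l y))

    pos : Place → Fin (suc m)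
    pos nothing        = zero
    pos (just (i , j)) = suc (R i j)

    pos-injective : Inj pos
    pos-injective {nothing} {nothing} eq = refl
    pos-injective {just _}  {just _}  eq = cong just (R-injective (Fin.suc-injective eq))

    place? : ∀ p → Dec (∃[ x ] pos x ≡ p)
    place? zero = yes (nothing , refl)
    place? (suc p) with Fin.any? (λ i → Fin.any? λ j → R i j Fin.≟ p)
    ... | yes (i , j , eq) = yes (just (i , j) , cong suc eq)
    ... | no ¬R            = no λ { (just (i , j) , eq) → ¬R (i , j , Fin.suc-injective eq) }

    π : Fin k → Fin (suc m) → Fin (suc m)
    π l p with place? p
    ... | yes (x , _) = pos (σ l x)
    ... | no _        = p

    π-injective : ∀ l → Inj (π l)
    π-injective l {p} {q} eq with place? p | place? q
    ... | yes (x , e) | yes (y , e′) =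
      trans (sym e) (trans (cong pos (σ-injective l (pos-injective eq))) e′)
    ... | yes (x , e) | no ¬q = contradiction (σ l x , eq) ¬q
    ... | no ¬p | yes (y , e) = contradiction (σ l y , sym eq) ¬p
    ... | no _  | no _        = eq

    row⁺ : Fin (suc m) → Fin k → Fin n
    row⁺ zero    l = u l
    row⁺ (suc p) l = row p l

    row⁺-injective : ∀ l {p q} → row⁺ p l ≡ row⁺ q l → p ≡ q
    row⁺-injective l {zero}  {zero}  eq = refl
    row⁺-injective l {zero}  {suc q} eq = contradiction (sym eq) (u-free l q)
    row⁺-injective l {suc p} {zero}  eq = contradiction eq (u-free l p)
    row⁺-injective l {suc p} {suc q} eq = cong suc (injective l eq)

    place-clique : ∀ x {l l′} → l ≢ l′ → (l , row⁺ (pos (σ l x)) l) ~ (l′ , row⁺ (pos (σ l′ x)) l′)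
    place-clique nothing l≢l′ = R~R (l≢l′ ∘ cong proj₁) l≢l′
    place-clique (just (i , j)) {l} {l′} l≢l′ with i Fin.≟ j | i Fin.≟ l | j Fin.≟ l | i Fin.≟ l′ | j Fin.≟ l′
    ... | yes _ | yes refl | _ | yes refl | _ = contradiction refl l≢l′
    ... | yes _ | yes refl | _ | no _     | _ = u~R l≢l′
    ... | yes _ | no _     | _ | yes refl | _ = ~-sym (u~R (l≢l′ ∘ sym))
    ... | yes _ | no _     | _ | no _     | _ = R~R (l≢l′ ∘ cong proj₂) l≢l′
    ... | no _  | _ | yes refl | _ | yes refl = contradiction refl l≢l′
    ... | no i≢j | _ | yes refl | _ | no _    = R~R (i≢j ∘ cong proj₂) l≢l′
    ... | no i≢j | _ | no _     | _ | yes refl = R~R (i≢j ∘ sym ∘ cong proj₂) l≢l′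
    ... | no _  | _ | no _     | _ | no _     = clique (R i j) l≢l′

    exchanged : Packing (suc m)
    exchanged = record
      { row       = λ p l → row⁺ (π l p) l
      ; injective = λ l → π-injective l ∘ row⁺-injective l
      ; clique    = clique′
      }
      where
      clique′ : ∀ p {l l′} → l ≢ l′ → (l , row⁺ (π l p) l) ~ (l′ , row⁺ (π l′ p) l′)
      clique′ p l≢l′ with place? p
      ... | yes (x , _) = place-clique x l≢l′
      clique′ zero    l≢l′ | no ¬zero = contradiction (nothing , refl) ¬zero
      clique′ (suc p) l≢l′ | no _     = clique p l≢l′

  Rich : ℕ → (i : Fin k) → Fin n → Fin k → Set
  Rich D i v j = Σ[ g ∈ (Fin D → Fin n) ] Inj g × ∀ y → (i , v) ~ (j , g y)

  -- One application of `link` consumes `S` transversals. A vertex with `D` neighbours in a class,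
  -- where `D` is at least `S + S`, still has one outside at most `S` uncovered vertices and the
  -- rows chosen before.
  module Extension
    (N : ℕ) (D : ℕ) (S+S≤D : (k * k) * N + (k * k) * N ≤ D) (D≤n : D ≤ n)
    (link : (R : Families n k (k * k) N) → DisjointFamilies R →
            Σ[ f ∈ (Fin (k * k) → Fin N) ] ∀ {a b l l′} → a ≢ b → l ≢ l′ →
              (l , R a (f a) l) ~ (l′ , R b (f b) l′))
    (rich-or-rich : ∀ {i j v v′} → i ≢ j → v ≢ v′ → Rich D i v j ⊎ Rich D i v′ j)
    where

    S : ℕ
    S = (k * k) * N

    module _ {d m : ℕ} (Q : Packing m) (m+d≡n : m + d ≡ n) where

      open Packing Q

      private
        module U (l : Fin k) where
          open Complement (complement (λ p → row p l) (injective l) m+d≡n) public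

      -- Uncovered vertices supply all the families. The new clique takes its vertex in class `l`
      -- from the family indexed `(l , l)`, so that its vertices come from distinct, mutually joined
      -- transversals.
      extend-sparse : S ≤ d → Packing (suc m)
      extend-sparse S≤d = record
        { row       = λ { zero l → X l ; (suc p) l → row p l }
        ; injective = λ
          { l {zero} {zero} _ → refl
          ; l {zero} {suc q} eq → contradiction (sym eq) (U.avoids l q _)
          ; l {suc p} {zero} eq → contradiction eq (U.avoids l p _)
          ; l {suc p} {suc q} eq → cong suc (injective l eq) }
        ; clique    = λ
          { zero l≢l′ → proj₂ linked (λ eq → l≢l′ (proj₁ (Fin.combine-injective _ _ _ _ eq))) l≢l′
          ; (suc p) → clique p }
        }
        where
        R : Families n k (k * k) N
        R a x l = U.free l (inject≤ (combine a x) S≤d)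

        linked = link R λ a x b y l eq →
          Fin.combine-injective a x b y (Fin.inject≤-injective S≤d S≤d _ _ (U.injective l eq))

        X : Fin k → Fin n
        X l = R (combine l l) (proj₁ linked (combine l l)) l

      -- Greedy choice: among the `D` values of `g zero` one avoids the `d` uncovered vertices of
      -- its class and the `t` vertices there of rows chosen before. Not being uncovered, it lies on
      -- a row, and that row is new.
      choose-rows : ∀ t → d + t ≤ D → (cls : Fin t → Fin k) (g : Fin t → Fin D → Fin n) → (∀ z → Inj (g z)) →
        Σ[ F ∈ (Fin t → Fin m) ] Inj F × ∀ z → ∃[ y ] row (F z) (cls z) ≡ g z y
      choose-rows zero    _    cls g g-inj = (λ ()) , (λ { {()} }) , λ ()
      choose-rows (suc t) room cls g g-inj
        with F , F-inj , F∈ ← choose-rows t (≤-trans (+-monoʳ-≤ d (n≤1+n t)) room)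
               (cls ∘ suc) (g ∘ suc) (λ z → g-inj (suc z))
        with y , y-fresh ← fresh (g zero) (g-inj zero)
               ([ U.free (cls zero) , (λ z → row (F z) (cls zero)) ]′ ∘ splitAt d)
               (≤-trans (≤-reflexive (sym (+-suc d t))) room)
        with U.covers (cls zero) (g zero y)
      ... | inj₂ (j , eq) = contradiction
        (trans (cong [ U.free (cls zero) , (λ z → row (F z) (cls zero)) ]′ (Fin.splitAt-↑ˡ d j t)) eq)
        (y-fresh (j ↑ˡ t))
      ... | inj₁ (p , eq) = F′ , F′-inj , λ { zero → y , eq ; (suc z) → F∈ z }
        where
        F′ : Fin (suc t) → Fin m
        F′ zero    = p
        F′ (suc z) = F z

        p≢F : ∀ z → p ≢ F z
        p≢F z refl = y-fresh (d ↑ʳ z)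
          (trans (cong [ U.free (cls zero) , (λ z → row (F z) (cls zero)) ]′ (Fin.splitAt-↑ʳ d t z)) eq)

        F′-inj : Inj F′
        F′-inj {zero}  {zero}   _  = refl
        F′-inj {zero}  {suc z}  eq = contradiction eq (p≢F z)
        F′-inj {suc z} {zero}   eq = contradiction (sym eq) (p≢F z)
        F′-inj {suc z} {suc z′} eq = cong suc (F-inj eq)

      module _ (u : Fin k → Fin n) (u-free : ∀ l p → row p l ≢ u l)
               (rich : ∀ {i j} → i ≢ j → Rich D i (u i) j) (d≤S : d ≤ S) where

        private
          Cell = Fin k × Fin k

          cell : Fin S → Cell
          cell z = remQuot k (proj₁ (remQuot {k * k} N z))

          neighbours : ∀ ((i , j) : Cell) → Σ[ g ∈ (Fin D → Fin n) ] Inj g × (i ≢ j → ∀ y → (i , u i) ~ (j , g y))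
          neighbours (i , j) with i Fin.≟ j
          -- The rows `R i i` need no adjacency to `u i`, so any `D` vertices serve.
          ... | yes i≡j =
            (λ y → inject≤ y D≤n) , Fin.inject≤-injective D≤n D≤n _ _ , λ i≢j → contradiction i≡j i≢j
          ... | no i≢j with g , g-inj , adj ← rich i≢j = g , g-inj , λ _ → adj

          chosen = choose-rows S (≤-trans (+-monoˡ-≤ S d≤S) S+S≤D) (proj₂ ∘ cell)
            (proj₁ ∘ neighbours ∘ cell) (λ z → proj₁ (proj₂ (neighbours (cell z))))

          F : Fin S → Fin m
          F = proj₁ chosen

          F-injective : Inj F
          F-injective = proj₁ (proj₂ chosen)

          linked = link (λ a x → row (F (combine a x))) λ a x b y l eq →
            Fin.combine-injective a x b y (F-injective (injective l eq))

          slot : Fin k → Fin k → Fin S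
          slot i j = combine (combine i j) (proj₁ linked (combine i j))

          cell-slot : ∀ i j → cell (slot i j) ≡ (i , j)
          cell-slot i j = trans
            (cong (remQuot k ∘ proj₁) (Fin.remQuot-combine (combine i j) _)) (Fin.remQuot-combine i j)

          u~ : ∀ z → let i , j = cell z in i ≢ j → (i , u i) ~ (j , row (F z) j)
          u~ z i≢j with y , eq ← proj₂ (proj₂ chosen) z =
            subst (λ v → (proj₁ (cell z) , u (proj₁ (cell z))) ~ (proj₂ (cell z) , v)) (sym eq)
              (proj₂ (proj₂ (neighbours (cell z))) i≢j y)

        -- Family `(i , j)` consists of `N` rows whose vertices in class `j` are neighbours of `u i`
        -- if `i ≢ j`. The row that `link` selects from it serves as `R i j`.
        extend-dense : Packing (suc m)
        extend-dense = Exchange.exchanged Q u u-free (λ i j → F (slot i j))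
          (λ {i} {j} {i′} {j′} eq →
            trans (sym (cell-slot i j)) (trans (cong cell (F-injective eq)) (cell-slot i′ j′)))
          (λ {i} {j} → subst (λ (i′ , j′) → i′ ≢ j′ → (i′ , u i′) ~ (j′ , row (F (slot i j)) j′))
            (cell-slot i j) (u~ (slot i j)))
          (λ {i} {j} {i′} {j′} ij≢ → proj₂ linked (λ eq → ij≢
            (trans (sym (Fin.remQuot-combine i j)) (trans (cong (remQuot k) eq) (Fin.remQuot-combine i′ j′)))))

      free-rich : k ≤ d → ∀ i → ∃[ c ] ∀ {j} → i ≢ j → Rich D i (U.free i c) j
      free-rich k≤d i
        with c , rich ← select-other (λ c → U.free i (inject≤ c k≤d))
               (Fin.inject≤-injective k≤d k≤d _ _ ∘ U.injective i) i (Rich D i) rich-or-rich =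
        inject≤ c k≤d , rich

      extend : k ≤ d → Packing (suc m)
      extend k≤d with ≤-total S d
      ... | inj₁ S≤d = extend-sparse S≤d
      ... | inj₂ d≤S = extend-dense (λ i → U.free i (proj₁ (free-rich k≤d i))) (λ l p → U.avoids l p _)
        (λ {i} → proj₂ (free-rich k≤d i)) d≤S

-- From feedback arc sets to packings

monochromatic : ∀ {n} a b {P Q : Fin n → Set} → a + b ≤ n → (∀ i → P i ⊎ Q i) →
  (Σ[ e ∈ (Fin a → Fin n) ] Inj e × ∀ y → P (e y)) ⊎ (Σ[ e ∈ (Fin b → Fin n) ] Inj e × ∀ y → Q (e y))
monochromatic zero    b       _ _ = inj₁ ((λ ()) , (λ { {()} }) , λ ())
monochromatic (suc a) zero    _ _ = inj₂ ((λ ()) , (λ { {()} }) , λ ())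
monochromatic {suc n} (suc a) (suc b) {P} {Q} (s≤s a+b≤n) colour with colour zero
... | inj₁ p with monochromatic a (suc b) a+b≤n (colour ∘ suc)
...   | inj₂ (e , inj , Qe) = inj₂ (suc ∘ e , inj ∘ Fin.suc-injective , Qe)
...   | inj₁ (e , inj , Pe) = inj₁ ((λ { zero → zero ; (suc y) → suc (e y) })
        , (λ { {zero} {zero} _ → refl ; {suc _} {suc _} eq → cong suc (inj (Fin.suc-injective eq)) })
        , λ { zero → p ; (suc y) → Pe y })
monochromatic {suc n} (suc a) (suc b) {P} {Q} (s≤s a+b≤n) colour | inj₂ q
  with monochromatic (suc a) b (≤-trans (≤-reflexive (sym (+-suc a b))) a+b≤n) (colour ∘ suc)
...   | inj₁ (e , inj , Pe) = inj₁ (suc ∘ e , inj ∘ Fin.suc-injective , Pe)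
...   | inj₂ (e , inj , Qe) = inj₂ ((λ { zero → zero ; (suc y) → suc (e y) })
        , (λ { {zero} {zero} _ → refl ; {suc _} {suc _} eq → cong suc (inj (Fin.suc-injective eq)) })
        , λ { zero → q ; (suc y) → Qe y })

module Descent {n k b : ℕ} (τ : Tournament n k) (H : ArcSet (Vertex n k)) (height : Vertex n k → Fin b)
  (height-drops : ∀ {u v} → T (arcs τ (u , v)) → ¬ T (H (u , v)) → height v Fin.< height u) where

  _~_ : Vertex n k → Vertex n k → Set
  _~_ = Adjacent H

  _~?_ : ∀ u v → Dec (u ~ v)
  u ~? v = T? (H (u , v)) ⊎-dec T? (H (v , u))

  drops : ∀ {u v} → arcs τ (u , v) ≡ true → ¬ u ~ v → height v Fin.< height u
  drops eq ≁ = height-drops (subst T (sym eq) tt) (≁ ∘ inj₁)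

  drops′ : ∀ {i j a b} → i ≢ j → arcs τ ((i , a) , (j , b)) ≡ false → ¬ (i , a) ~ (j , b) →
           height (i , a) Fin.< height (j , b)
  drops′ {a = a} {b} i≢j eq ≁ = drops (trans (arcs-between τ a b i≢j) (cong not eq)) (≁ ∘ Sum.swap)

  -- If the vertices were not adjacent in `H`, the height would drop along the arc between them,
  -- contrary to the prescribed orientation. A tie contradicts this drop as well.
  backward : ∀ {i j a b} → i ≢ j → (lt? : Dec (height (i , a) Fin.< height (j , b))) →
             arcs τ ((i , a) , (j , b)) ≡ does lt? → (i , a) ~ (j , b)
  backward {i} {j} {a} {b} i≢j lt? eq with (i , a) ~? (j , b) | lt?
  ... | yes adj | _      = adj
  ... | no ≁    | yes lt = contradiction (drops eq ≁) (<⇒≯ lt)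
  ... | no ≁    | no ≮   = contradiction (drops′ i≢j eq ≁) ≮

  -- Otherwise the height would drop along every arc of the cycle and be less than itself.
  four-cycle : ∀ {i j u u′ a b} → i ≢ j →
    arcs τ ((i , u) , (j , a)) ≡ true → arcs τ ((i , u′) , (j , a)) ≡ false →
    arcs τ ((i , u) , (j , b)) ≡ false → arcs τ ((i , u′) , (j , b)) ≡ true →
    ((i , u) ~ (j , a) ⊎ (i , u′) ~ (j , a)) ⊎ ((i , u) ~ (j , b) ⊎ (i , u′) ~ (j , b))
  four-cycle {i} {j} {u} {u′} {a} {b} i≢j u→a a→u′ b→u u′→b
    with (i , u) ~? (j , a) | (i , u′) ~? (j , a) | (i , u) ~? (j , b) | (i , u′) ~? (j , b)
  ... | yes p | _ | _ | _ = inj₁ (inj₁ p)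
  ... | _ | yes p | _ | _ = inj₁ (inj₂ p)
  ... | _ | _ | yes p | _ = inj₂ (inj₁ p)
  ... | _ | _ | _ | yes p = inj₂ (inj₂ p)
  ... | no p | no q | no r | no s = contradiction
    (<-trans (drops′ i≢j b→u r) (<-trans (drops u′→b s) (<-trans (drops′ i≢j a→u′ q) (drops u→a p))))
    (<-irrefl refl)

  linked-adjacent : ∀ {s N} {R : Families n k s N} → ((f , _) : Oriented τ R (λ a x l → height (l , R a x l))) →
    ∀ {a b l l′} → a ≢ b → l ≢ l′ → (l , R a (f a) l) ~ (l′ , R b (f b) l′)
  linked-adjacent (f , linked) {a} {b} {l} {l′} a≢b l≢l′ with Fin.<-cmp l l′
  ... | tri< l<l′ _ _ = backward l≢l′ (_ Fin.<? _) (linked a b l l′ a≢b l<l′)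
  ... | tri≈ _ l≡l′ _ = contradiction l≡l′ l≢l′
  ... | tri> _ _ l′<l = Sum.swap (backward (l≢l′ ∘ sym) (_ Fin.<? _) (linked b a l′ l (a≢b ∘ sym) l′<l))

module Deterministic (n k h : ℕ) where

  -- `S` is the size of `k * k` families of `(k * k) * h` transversals each. `D` doubles it to leave
  -- room for the greedy choice of rows, and `w` doubles `D` so that one of two competing vertices
  -- gets neighbours from `D` groups.
  S D w : ℕ
  S = (k * k) * ((k * k) * h)
  D = S + S
  w = D + D

  module _ (room : 2 * (w * h) ≤ n) (D≤n : D ≤ n) where

    open Alternation n k w h room

    module _ (τ : Tournament n k)
      (¬linking-fails : ¬ T (linking-fails n k (k * k) h (suc (k * n)) τ))
      (¬alternation-fails : ¬ T (alternation-fails τ))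
      where

      module _ (H : ArcSet (Vertex n k)) (fas : IsFeedbackArcSet (arcs τ) H) where

        open Height {M = k * n} Fin.*↔× (arcs τ) H fas using (height; height-drops)

        open Descent τ H height height-drops

        link : (R : Families n k (k * k) ((k * k) * h)) → DisjointFamilies R →
               Σ[ f ∈ (Fin (k * k) → Fin ((k * k) * h)) ] ∀ {a b l l′} → a ≢ b → l ≢ l′ →
                 (l , R a (f a) l) ~ (l′ , R b (f b) l′)
        link R disj = proj₁ linked , linked-adjacent {R = R} linked
          where
          linked : Oriented τ R (λ a x l → height (l , R a x l))
          linked = linking n k (k * k) h (suc (k * n)) τ ¬linking-fails R (λ a x l → height (l , R a x l)) disj

        open Packings n k _~_ Sum.swap

        -- Every group contains a 4-cycle through `v` and `v′`, which yields a vertex of class `j`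
        -- adjacent in `H` to one of the two. One of them is served by `D` of the `w` groups, at
        -- distinct vertices.
        rich-or-rich : ∀ {i j v v′} → i ≢ j → v ≢ v′ → Rich D i v j ⊎ Rich D i v′ j
        rich-or-rich {i} {j} {v} {v′} i≢j v≢v′ =
          Sum.map rich rich (monochromatic D D ≤-refl (λ g → proj₂ (hit g)))
          where
          hit : ∀ g → Σ (Fin 2 × Fin h) λ (e , x) → (i , v) ~ (j , slot e g x) ⊎ (i , v′) ~ (j , slot e g x)
          hit g =
            let x , v→a , a→v′ , b→v , v′→b = alternation τ ¬alternation-fails i≢j v≢v′ g
            in [ ((0F , x) ,_) , ((1F , x) ,_) ]′ (four-cycle i≢j v→a a→v′ b→v v′→b)

          place : Fin w → Fin n
          place g = let (e , x) , _ = hit g in slot e g x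

          place-injective : Inj place
          place-injective {g} {g′} eq = let (e , x) , _ = hit g ; (e′ , x′) , _ = hit g′ in
            proj₁ (proj₂ (slot-injective {e} {g} {x} {e′} {g′} {x′} eq))

          rich : ∀ {v} → Σ[ e ∈ (Fin D → Fin w) ] Inj e × (∀ y → (i , v) ~ (j , place (e y))) → Rich D i v j
          rich (e , inj , adj) = place ∘ e , inj ∘ place-injective , adj

        packings : ∀ m → m ≤ suc n ∸ k → Packing m
        packings zero    _  = empty
        packings (suc m) m< = extend (packings m (<⇒≤ m<)) (m+[n∸m]≡n (m+n≤o⇒m≤o m m+k≤n))
          (m+n≤o⇒m≤o∸n k (≤-trans (≤-reflexive (+-comm k m)) m+k≤n))
          where
          open Extension ((k * k) * h) D ≤-refl D≤n link rich-or-rich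
          m+k≤n : m + k ≤ n
          -- The truncated difference `suc n ∸ k` exceeds `m`, so it is positive and hence exact;
          -- thus `k` vertices of each class are still uncovered.
          m+k≤n = s≤s⁻¹ (m≤o∸n⇒m+n≤o (suc m) (<⇒≤ (m∸n≢0⇒n<m (m<n⇒n≢0 m<))) m<)

        disjoint-cliques : HasDisjointCliques H (suc n ∸ k) k
        disjoint-cliques = tabulate (λ p → tabulate λ l → l , row p l) ,
          All.tabulate⁺ (λ p → Unique.tabulate⁺ (cong proj₁) , AllPairs.tabulate⁺ (clique p)) ,
          AllPairs.tabulate⁺ λ {p} {q} p≢q v (v∈p , v∈q) → p≢q (same (Any.tabulate⁻ v∈p) (Any.tabulate⁻ v∈q))
          where
          open Packing (packings (suc n ∸ k) ≤-refl)
          same : ∀ {p q v} → ∃[ l ] v ≡ (l , row p l) → ∃[ l ] v ≡ (l , row q l) → p ≡ q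
          same (l , eq) (l′ , eq′) with trans (sym eq) eq′
          ... | e with cong proj₁ e
          ...   | refl = injective l (cong proj₂ e)

      good : Good τ
      good H (fas , _) = disjoint-cliques H fas

-- Asymptotics

-- Bernoulli's inequality `1 + j / K <= (1 + 1 / K) ^ j`, cleared of denominators.
bernoulli : ∀ K j → (K + j) * K ^ j ≤ K * suc K ^ j
bernoulli K zero    = ≤-reflexive (cong (_* 1) (+-identityʳ K))
bernoulli K (suc j) = begin
  (K + suc j) * (K * K ^ j)          ≤⟨ m≤m+n _ (j * K ^ j) ⟩
  (K + suc j) * (K * K ^ j) + j * K ^ j ≡⟨ rearrange K j (K ^ j) ⟩
  suc K * ((K + j) * K ^ j)          ≤⟨ *-monoʳ-≤ (suc K) (bernoulli K j) ⟩
  suc K * (K * suc K ^ j)            ≡⟨ *-exchange (suc K) K _ ⟩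
  K * (suc K * suc K ^ j)            ∎
  where
  open ≤-Reasoning
  rearrange : ∀ K j x → (K + suc j) * (K * x) + j * x ≡ suc K * ((K + j) * x)
  rearrange = solve-∀

doubling : ∀ K .{{_ : NonZero K}} → 2 * K ^ K ≤ suc K ^ K
doubling K = *-cancelˡ-≤ K (begin
  K * (2 * K ^ K)     ≡⟨ rearrange K (K ^ K) ⟩
  (K + K) * K ^ K     ≤⟨ bernoulli K K ⟩
  K * suc K ^ K       ∎)
  where
  open ≤-Reasoning
  rearrange : ∀ K x → K * (2 * x) ≡ (K + K) * x
  rearrange = solve-∀

n<2^n : ∀ n → n < 2 ^ n
n<2^n zero    = s≤s z≤n
n<2^n (suc n) = begin
  2 + n            ≤⟨ s≤s (m≤n+m (suc n) n) ⟩
  suc n + suc n    ≤⟨ +-mono-≤ (n<2^n n) (n<2^n n) ⟩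
  2 ^ n + 2 ^ n    ≡⟨ cong (2 ^ n +_) (+-identityʳ _) ⟨
  2 ^ suc n        ∎
  where open ≤-Reasoning

^-distribʳ-* : ∀ m n o → (m * n) ^ o ≡ m ^ o * n ^ o
^-distribʳ-* m n zero    = refl
^-distribʳ-* m n (suc o) = trans (cong (m * n *_) (^-distribʳ-* m n o)) (*-interchange m n (m ^ o) (n ^ o))

Eventually : (ℕ → Set) → Set
Eventually P = ∃[ m ] ∀ n → m ≤ n → P n

-- By `doubling`, every `K` factors `1 + 1 / K` gain a factor of 2. With `u` the quotient of `h` by
-- `M`, this gives `2 ^ (suc C * u)`: of the `C + 1` factors `2 ^ u`, `C` dominate `suc u ^ C`, and
-- one dominates `E * M ^ C` once `h` passes the threshold.
exponential-decay : ∀ K .{{_ : NonZero K}} C E → Eventually λ h → E * suc h ^ C * K ^ h ≤ suc K ^ h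
exponential-decay K C E = E * M ^ C * M , decay
  where
  open ≤-Reasoning
  M = K * suc C

  instance
    M≢0 : NonZero M
    M≢0 = m*n≢0 K (suc C)

  decay : ∀ h → E * M ^ C * M ≤ h → E * suc h ^ C * K ^ h ≤ suc K ^ h
  decay h large = begin
    E * suc h ^ C * K ^ h                   ≤⟨ *-monoˡ-≤ (K ^ h) poly ⟩
    2 ^ e * K ^ h                           ≡⟨ cong (λ z → 2 ^ e * K ^ z) h≡ ⟩
    2 ^ e * K ^ (v + K * e)                 ≡⟨ cong (2 ^ e *_) (^-distribˡ-+-* K v (K * e)) ⟩
    2 ^ e * (K ^ v * K ^ (K * e))           ≡⟨ *-exchange (2 ^ e) (K ^ v) _ ⟩
    K ^ v * (2 ^ e * K ^ (K * e))           ≡⟨ cong (λ z → K ^ v * (2 ^ e * z)) (^-*-assoc K K e) ⟨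
    K ^ v * (2 ^ e * (K ^ K) ^ e)           ≡⟨ cong (K ^ v *_) (^-distribʳ-* 2 (K ^ K) e) ⟨
    K ^ v * (2 * K ^ K) ^ e                 ≤⟨ *-mono-≤ (^-monoˡ-≤ v (n≤1+n K)) (^-monoˡ-≤ e (doubling K)) ⟩
    suc K ^ v * (suc K ^ K) ^ e             ≡⟨ cong (suc K ^ v *_) (^-*-assoc (suc K) K e) ⟩
    suc K ^ v * suc K ^ (K * e)             ≡⟨ ^-distribˡ-+-* (suc K) v (K * e) ⟨
    suc K ^ (v + K * e)                     ≡⟨ cong (suc K ^_) h≡ ⟨
    suc K ^ h                               ∎
    where
    u = h ℕ./ M
    v = h % M
    e = suc C * u

    h≡ : h ≡ v + K * e
    h≡ = trans (m≡m%n+[m/n]*n h M) (cong (v +_) (rearrange u K (suc C)))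
      where
      rearrange : ∀ u K C → u * (K * C) ≡ K * (C * u)
      rearrange = solve-∀

    h< : suc h ≤ M * suc u
    h< = begin
      suc h                ≡⟨ cong suc (m≡m%n+[m/n]*n h M) ⟩
      suc v + u * M        ≤⟨ +-monoˡ-≤ (u * M) (m%n<n h M) ⟩
      M + u * M            ≡⟨ *-comm (suc u) M ⟩
      M * suc u            ∎

    poly : E * suc h ^ C ≤ 2 ^ e
    poly = begin
      E * suc h ^ C                 ≤⟨ *-monoʳ-≤ E (^-monoˡ-≤ C h<) ⟩
      E * (M * suc u) ^ C           ≡⟨ cong (E *_) (^-distribʳ-* M (suc u) C) ⟩
      E * (M ^ C * suc u ^ C)       ≡⟨ *-assoc E (M ^ C) _ ⟨
      E * M ^ C * suc u ^ C         ≤⟨ *-mono-≤ E≤ (^-monoˡ-≤ C (n<2^n u)) ⟩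
      2 ^ u * (2 ^ u) ^ C           ≡⟨ cong (2 ^ u *_) (trans (^-*-assoc 2 u C) (cong (2 ^_) (*-comm u C))) ⟩
      2 ^ u * 2 ^ (C * u)           ≡⟨ ^-distribˡ-+-* 2 u (C * u) ⟨
      2 ^ e                         ∎
      where
      E≤ : E * M ^ C ≤ 2 ^ u
      E≤ = begin
        E * M ^ C                        ≡⟨ m*n/n≡m (E * M ^ C) M ⟨
        E * M ^ C * M ℕ./ M       ≤⟨ /-monoˡ-≤ M large ⟩
        u                                ≤⟨ <⇒≤ (n<2^n u) ⟩
        2 ^ u                            ∎

-- Here `h` is the integer part of the square root of `n / A`; it grows by at most one when `n`
-- does.
scaled-root : ∀ A .{{_ : NonZero A}} n → ∃[ h ] A * (h * h) ≤ n × n < A * (suc h * suc h)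
scaled-root A zero    = 0 , ≤-reflexive (*-zeroʳ A) , subst (0 <_) (sym (*-identityʳ A)) (>-nonZero⁻¹ A)
scaled-root A (suc n) with h , lo , hi ← scaled-root A n with A * (suc h * suc h) ≤? suc n
... | no ≰   = h , m≤n⇒m≤1+n lo , ≰⇒> ≰
... | yes ≤n = suc h , ≤n , ≤-<-trans hi (*-monoʳ-< A (*-mono-< (n<1+n (suc h)) (n<1+n (suc h))))

scaled-root-large : ∀ A {n h} m → n < A * (suc h * suc h) → A * (m * m) ≤ n → m ≤ h
scaled-root-large A {n} {h} m hi lo with m ≤? h
... | yes m≤h = m≤h
... | no m≰h  = contradiction (≤-trans (*-monoʳ-≤ A (*-mono-≤ (≰⇒> m≰h) (≰⇒> m≰h))) lo) (<⇒≱ hi)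

-- With `X` codes, each failing with probability at most `Y / L`, the failure probability `N / T` is
-- at most `X * Y / L`, hence at most `1 / E` if `E` is nonzero.
cancel-rare : ∀ L X Y N T E .{{_ : NonZero L}} → L * N ≤ X * (Y * T) → E * X * Y ≤ L → E * N ≤ T
cancel-rare L X Y N T E rare small = *-cancelˡ-≤ L (begin
  L * (E * N)          ≡⟨ *-exchange L E N ⟩
  E * (L * N)          ≤⟨ *-monoʳ-≤ E rare ⟩
  E * (X * (Y * T))    ≡⟨ assoc E X Y T ⟩
  E * X * Y * T        ≤⟨ *-monoˡ-≤ T small ⟩
  L * T                ∎)
  where
  open ≤-Reasoning
  assoc : ∀ a b c d → a * (b * (c * d)) ≡ a * b * c * d
  assoc = solve-∀

-- From counts to probabilities

filter-count : (xs : List A) {P : Pred A ℓ} (P? : Decidable P) →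
               length (filter P? xs) + count xs (not ∘ does ∘ P?) ≡ length xs
filter-count []       P? = refl
filter-count (x ∷ xs) P? with does (P? x)
... | true  = cong suc (filter-count xs P?)
... | false = trans (+-suc _ _) (cong suc (filter-count xs P?))

count-failures : (xs : List A) {P : Pred A ℓ} (P? : Decidable P) (f g : A → Bool) →
                 (∀ a → ¬ T (f a) → ¬ T (g a) → P a) →
                 count xs (not ∘ does ∘ P?) ≤ count xs f + count xs g
count-failures xs P? f g good = count-⊎ xs _ f g fails
  where
  fails : ∀ a → T (not (does (P? a))) → T (f a) ⊎ T (g a)
  fails a t with P? a | T? (f a) | T? (g a)
  ... | _     | yes p | _     = inj₁ p
  ... | _     | no _  | yes q = inj₂ q
  ... | no ¬P | no ¬f | no ¬g = contradiction (good a ¬f ¬g) ¬P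

fractions-sum : ∀ G B T .{{_ : NonZero T}} → G + B ≡ T → ℤ.+ G / T ℚ.+ ℤ.+ B / T ≡ 1ℚ
fractions-sum G B T@(suc t) eq = ℚ.toℚᵘ-injective (begin
  toℚᵘ (ℤ.+ G / T ℚ.+ ℤ.+ B / T)            ≈⟨ ℚ.toℚᵘ-homo-+ (ℤ.+ G / T) (ℤ.+ B / T) ⟩
  toℚᵘ (ℤ.+ G / T) ℚᵘ.+ toℚᵘ (ℤ.+ B / T)
    ≈⟨ ℚᵘ.+-cong (ℚ.toℚᵘ-fromℚᵘ (mkℚᵘ (ℤ.+ G) t)) (ℚ.toℚᵘ-fromℚᵘ (mkℚᵘ (ℤ.+ B) t)) ⟩
  mkℚᵘ (ℤ.+ G) t ℚᵘ.+ mkℚᵘ (ℤ.+ B) t        ≈⟨ *≡* integers ⟩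
  toℚᵘ 1ℚ                                   ∎)
  where
  open ℚᵘ.≃-Reasoning
  integers : (ℤ.+ G ℤ.* ℤ.+ T ℤ.+ ℤ.+ B ℤ.* ℤ.+ T) ℤ.* ℤ.+ 1 ≡ ℤ.+ 1 ℤ.* ℤ.+ (T * T)
  integers = trans (ℤ.*-identityʳ _) (trans (sym (ℤ.*-distribʳ-+ (ℤ.+ T) (ℤ.+ G) (ℤ.+ B)))
    (trans (cong (λ z → ℤ.+ z ℤ.* ℤ.+ T) eq) (trans (sym (ℤ.pos-* T T)) (sym (ℤ.*-identityˡ _)))))

distance-to-one : ∀ G B T .{{_ : NonZero T}} → G + B ≡ T → ℚ.∣ ℤ.+ G / T ℚ.- 1ℚ ∣ ≡ ℤ.+ B / T
distance-to-one G B T eq = begin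
  ℚ.∣ γ ℚ.- 1ℚ ∣             ≡⟨ cong (λ z → ℚ.∣ γ ℚ.- z ∣) (fractions-sum G B T eq) ⟨
  ℚ.∣ γ ℚ.- (γ ℚ.+ β) ∣      ≡⟨ cong ℚ.∣_∣ difference ⟩
  ℚ.∣ ℚ.- β ∣                ≡⟨ ℚ.∣-p∣≡∣p∣ β ⟩
  ℚ.∣ β ∣                    ≡⟨ ℚ.0≤p⇒∣p∣≡p (ℚ.nonNegative⁻¹ β {{ℚ.normalize-nonNeg B T}}) ⟩
  β                          ∎
  where
  open ≡-Reasoning
  γ = ℤ.+ G / T
  β = ℤ.+ B / T
  difference : γ ℚ.- (γ ℚ.+ β) ≡ ℚ.- β
  difference = trans (cong (γ ℚ.+_) (ℚ.neg-distrib-+ γ β)) (trans (sym (ℚ.+-assoc γ (ℚ.- γ) (ℚ.- β)))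
    (trans (cong (ℚ._+ ℚ.- β) (ℚ.+-inverseʳ γ)) (ℚ.+-identityˡ _)))

-- For `q` the denominator of `ε` serves, as a positive rational is at least the reciprocal of its
-- denominator.
fraction-small : ∀ ε → 0ℚ ℚ.< ε → Σ[ q ∈ ℕ ] ∀ B T .{{_ : NonZero T}} → q * B < T → ℤ.+ B / T ℚ.< ε
fraction-small (mkℚ (ℤ.+ zero) _ _)   (ℚ.*<* (ℤ.+<+ ()))
fraction-small (mkℚ ℤ.-[1+ _ ] _ _)   (ℚ.*<* ())
fraction-small ε@(mkℚ (ℤ.+ suc p) q-1 _) _ = suc q-1 , below
  where
  below : ∀ B T .{{_ : NonZero T}} → suc q-1 * B < T → ℤ.+ B / T ℚ.< ε
  below B T@(suc t) lt = ℚ.toℚᵘ-cancel-< (ℚᵘ.<-respˡ-≃ (ℚᵘ.≃-sym (ℚ.toℚᵘ-fromℚᵘ (mkℚᵘ (ℤ.+ B) t)))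
    (*<* (subst₂ ℤ._<_ (ℤ.pos-* B (suc q-1)) (ℤ.pos-* (suc p) T) (ℤ.+<+ (begin-strict
      B * suc q-1      ≡⟨ *-comm B _ ⟩
      suc q-1 * B      <⟨ lt ⟩
      T                ≤⟨ m≤m+n T (p * T) ⟩
      suc p * T        ∎)))))
    where open ≤-Reasoning

uniform-distance-to-one : (xs : List A) .{{_ : NonZero (length xs)}} {P : Pred A ℓ} (P? : Decidable P) →
  ℚ.∣ uniform xs P? ℚ.- 1ℚ ∣ ≡ ℤ.+ count xs (not ∘ does ∘ P?) / length xs
uniform-distance-to-one xs P? = distance-to-one (length (filter P? xs)) _ (length xs) (filter-count xs P?)

Prℛ⟶1 : ∀ k {P : ∀ n → Pred (Tournament n k) ℓ} (P? : ∀ n → Decidable (P n)) →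
  (∀ q → Eventually λ n → q * count (tournaments n k) (not ∘ does ∘ P? n) < length (tournaments n k)) →
  (λ n → Prℛ n k (P? n)) ⟶ 1ℚ
Prℛ⟶1 k P? rare ε 0<ε with q , small ← fraction-small ε 0<ε with n₀ , rare-q ← rare q =
  n₀ , λ n n₀≤n → subst (ℚ._< ε)
    (sym (uniform-distance-to-one (tournaments n k) {{tournaments-nonZero n k}} (P? n)))
    (small _ _ {{tournaments-nonZero n k}} (rare-q n n₀≤n))

m≤m^n : ∀ m n .{{_ : NonZero n}} → m ≤ m ^ n
m≤m^n zero      (suc n) = z≤n
m≤m^n m@(suc _) (suc n) = m≤m*n m (m ^ n) {{m^n≢0 m n}}

-- Choice of parameters and the final estimate

module Bounds (k : ℕ) where

  -- The 4-cycles occupy `2 * (w * h) = α * (h * h)` vertices of a class, so `h` is taken as the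
  -- root of `n / α`. A linking code has `P * h` entries, each with at most `E₁ * suc h ^ 4` values,
  -- and there are at most `E₂ * suc h ^ 5` alternation codes.
  α P E₁ E₂ : ℕ
  α  = 8 * ((k * k) * (k * k))
  P  = (k * k) * (k * k) * k
  E₁ = α * suc (k * α)
  E₂ = (k * k) * (α * α * (4 * ((k * k) * (k * k))))

  module _ (n h : ℕ) (n≤ : n ≤ α * (suc h * suc h)) where

    open Deterministic n k h using (w)
    open ≤-Reasoning

    private
      z = suc h

    room≡ : 2 * (w * h) ≡ α * (h * h)
    room≡ = lemma k h
      where
      lemma : ∀ k h → let S = (k * k) * ((k * k) * h) in
              2 * (((S + S) + (S + S)) * h) ≡ 8 * ((k * k) * (k * k)) * (h * h)
      lemma = solve-∀

    labels : n * suc (k * n) ≤ E₁ * z ^ 4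
    labels = begin
      n * suc (k * n)                                   ≤⟨ *-mono-≤ n≤ (s≤s (*-monoʳ-≤ k n≤)) ⟩
      α * (z * z) * (1 + k * (α * (z * z)))            
        ≤⟨ *-monoʳ-≤ (α * (z * z)) (+-monoˡ-≤ (k * (α * (z * z))) (s≤s z≤n)) ⟩
      α * (z * z) * (z * z + k * (α * (z * z)))         ≡⟨ lemma α k z ⟩
      E₁ * z ^ 4                                        ∎
      where
      lemma : ∀ α k z → α * (z * z) * (z * z + k * (α * (z * z))) ≡
                        α * (1 + k * α) * (z * (z * (z * (z * 1))))
      lemma = solve-∀

    linking-codes : (n * suc (k * n)) ^ ((k * k) * ((k * k) * h) * k) ≤ (E₁ ^ P * z ^ (4 * P)) ^ h
    linking-codes = begin
      (n * suc (k * n)) ^ ((k * k) * ((k * k) * h) * k)  ≤⟨ ^-monoˡ-≤ ((k * k) * ((k * k) * h) * k) labels ⟩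
      (E₁ * z ^ 4) ^ ((k * k) * ((k * k) * h) * k)       ≡⟨ cong ((E₁ * z ^ 4) ^_) (lemma k h) ⟩
      (E₁ * z ^ 4) ^ (P * h)                             ≡⟨ ^-*-assoc (E₁ * z ^ 4) P h ⟨
      ((E₁ * z ^ 4) ^ P) ^ h                             ≡⟨ cong (_^ h) (^-distribʳ-* E₁ (z ^ 4) P) ⟩
      (E₁ ^ P * (z ^ 4) ^ P) ^ h                         ≡⟨ cong (λ x → (E₁ ^ P * x) ^ h) (^-*-assoc z 4 P) ⟩
      (E₁ ^ P * z ^ (4 * P)) ^ h                         ∎
      where
      lemma : ∀ k h → (k * k) * ((k * k) * h) * k ≡ (k * k) * (k * k) * k * h
      lemma = solve-∀

    -- The number of codes is bounded by the `h`-th power of a polynomial in `h`, and the failure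
    -- bound has exponent `h * h`, so the claim follows from the `h`-th power of the decay
    -- hypothesis. The step from `E` to `E ^ h` uses that `h` is nonzero.
    linking-small : ∀ E K .{{_ : NonZero h}} → E * E₁ ^ P * z ^ (4 * P) * K ^ h ≤ suc K ^ h →
      E * (n * suc (k * n)) ^ ((k * k) * ((k * k) * h) * k) * K ^ (h * h) ≤ suc K ^ (h * h)
    linking-small E K decay = begin
      E * (n * suc (k * n)) ^ ((k * k) * ((k * k) * h) * k) * K ^ (h * h)
        ≤⟨ *-monoˡ-≤ (K ^ (h * h)) (*-mono-≤ (m≤m^n E h) linking-codes) ⟩
      E ^ h * F ^ h * K ^ (h * h)      ≡⟨ cong₂ _*_ (^-distribʳ-* E F h) (^-*-assoc K h h) ⟨
      (E * F) ^ h * (K ^ h) ^ h        ≡⟨ ^-distribʳ-* (E * F) (K ^ h) h ⟨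
      (E * F * K ^ h) ^ h              ≡⟨ cong (λ x → (x * K ^ h) ^ h) (*-assoc E _ _) ⟨
      (E * E₁ ^ P * z ^ (4 * P) * K ^ h) ^ h ≤⟨ ^-monoˡ-≤ h decay ⟩
      (suc K ^ h) ^ h                  ≡⟨ ^-*-assoc (suc K) h h ⟩
      suc K ^ (h * h)                  ∎
      where
      F = E₁ ^ P * z ^ (4 * P)

    alternation-codes : (k * k) * ((n * n) * w) ≤ E₂ * z ^ 5
    alternation-codes = begin
      (k * k) * ((n * n) * w)
        ≤⟨ *-monoʳ-≤ (k * k) (*-mono-≤ (*-mono-≤ n≤ n≤) w≤) ⟩
      (k * k) * ((α * (z * z)) * (α * (z * z)) * (4 * ((k * k) * (k * k)) * z))
        ≡⟨ lemma (k * k) α (4 * ((k * k) * (k * k))) z ⟩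
      E₂ * z ^ 5 ∎
      where
      w≡ : ∀ k h → let S = (k * k) * ((k * k) * h) in (S + S) + (S + S) ≡ 4 * ((k * k) * (k * k)) * h
      w≡ = solve-∀
      w≤ : w ≤ 4 * ((k * k) * (k * k)) * z
      w≤ = ≤-trans (≤-reflexive (w≡ k h)) (*-monoʳ-≤ (4 * ((k * k) * (k * k))) (n≤1+n h))
      lemma : ∀ s α f z → s * ((α * (z * z)) * (α * (z * z)) * (f * z)) ≡
                          s * (α * α * f) * (z * (z * (z * (z * (z * 1)))))
      lemma = solve-∀

    alternation-small : ∀ E → E * E₂ * z ^ 5 * 16 ^ h ≤ 17 ^ h → E * ((k * k) * ((n * n) * w)) * 16 ^ h ≤ 17 ^ h
    alternation-small E decay = begin
      E * ((k * k) * ((n * n) * w)) * 16 ^ h    ≤⟨ *-monoˡ-≤ (16 ^ h) (*-monoʳ-≤ E alternation-codes) ⟩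
      E * (E₂ * z ^ 5) * 16 ^ h                 ≡⟨ cong (_* 16 ^ h) (*-assoc E E₂ _) ⟨
      E * E₂ * z ^ 5 * 16 ^ h                   ≤⟨ decay ⟩
      17 ^ h                                    ∎

bad : ∀ n k → Tournament n k → Bool
bad n k = not ∘ does ∘ good? {n} {k}

-- The factor 3, against two failure events, makes the final inequality strict.
combine-rare : ∀ {c T} q c₁ c₂ .{{_ : NonZero T}} →
               c ≤ c₁ + c₂ → 3 * q * c₁ ≤ T → 3 * q * c₂ ≤ T → q * c < T
combine-rare {c} {T} q c₁ c₂ c≤ rare₁ rare₂ = *-cancelˡ-< 3 _ _ (begin-strict
  3 * (q * c)                      ≡⟨ *-assoc 3 q c ⟨
  3 * q * c                        ≤⟨ *-monoʳ-≤ (3 * q) c≤ ⟩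
  3 * q * (c₁ + c₂)                ≡⟨ *-distribˡ-+ (3 * q) c₁ c₂ ⟩
  3 * q * c₁ + 3 * q * c₂          ≤⟨ +-mono-≤ rare₁ rare₂ ⟩
  T + T                            <⟨ +-monoʳ-< T (m<m+n T (>-nonZero⁻¹ T)) ⟩
  T + (T + T)                      ≡⟨ cong (λ z → T + (T + z)) (+-identityʳ T) ⟨
  3 * T                            ∎)
  where open ≤-Reasoning

-- As `h` is of order the square root of `n`, linking has `exp (O (h log h))` codes against a
-- failure bound `exp (- Ω (h²))`, and alternation has polynomially many against `exp (- Ω (h))`.
bad-rare : ∀ k .{{_ : NonZero k}} q → Eventually λ n →
           q * count (tournaments n k) (bad n k) < length (tournaments n k)
bad-rare k q = α * (h₀ * h₀) , rare
  where
  open Bounds k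
  K = 2 ^ linkC k (k * k)
  instance
    α≢0 : NonZero α
    α≢0 = m*n≢0 8 _ {{_}} {{m*n≢0 (k * k) (k * k) {{m*n≢0 k k}} {{m*n≢0 k k}}}}
    K≢0 : NonZero K
    K≢0 = m^n≢0 2 (linkC k (k * k))

  decay₁ = exponential-decay K (4 * P) (3 * q * E₁ ^ P)
  decay₂ = exponential-decay 16 5 (3 * q * E₂)
  -- The successor guarantees that `h` is nonzero.
  h₀ = suc (proj₁ decay₁ + proj₁ decay₂)

  rare : ∀ n → α * (h₀ * h₀) ≤ n → q * count (tournaments n k) (bad n k) < length (tournaments n k)
  rare n n≥ with h , lo , hi ← scaled-root α n =
    combine-rare q (count 𝒯 F₁) (count 𝒯 F₂) {{tournaments-nonZero n k}}
      (count-failures 𝒯 (good? {n} {k}) F₁ F₂ good-unless) rare₁ rare₂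
    where
    open ≤-Reasoning
    𝒯 = tournaments n k

    h≥ : h₀ ≤ h
    h≥ = scaled-root-large α h₀ hi n≥

    instance
      h≢0 : NonZero h
      h≢0 = >-nonZero (≤-trans (s≤s z≤n) h≥)

    open Deterministic n k h

    room : 2 * (w * h) ≤ n
    room = ≤-trans (≤-reflexive (room≡ n h (<⇒≤ hi))) lo

    D≤n : D ≤ n
    D≤n = begin
      D             ≤⟨ m≤m+n D D ⟩
      w             ≤⟨ m≤m*n w h ⟩
      w * h         ≤⟨ m≤m+n (w * h) _ ⟩
      2 * (w * h)   ≤⟨ room ⟩
      n             ∎

    F₁ F₂ : Tournament n k → Bool
    F₁ = linking-fails n k (k * k) h (suc (k * n))
    F₂ = Alternation.alternation-fails n k w h room

    good-unless : ∀ τ → ¬ T (F₁ τ) → ¬ T (F₂ τ) → Good τ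
    good-unless = good room D≤n

    X₁ = (n * suc (k * n)) ^ ((k * k) * ((k * k) * h) * k)
    X₂ = (k * k) * ((n * n) * w)

    rare₁ : 3 * q * count 𝒯 F₁ ≤ length 𝒯
    rare₁ = cancel-rare (suc K ^ (h * h)) X₁ (K ^ (h * h)) (count 𝒯 F₁) (length 𝒯) (3 * q)
      {{m^n≢0 (suc K) (h * h)}} (linking-fails-rare n k (k * k) h (suc (k * n)))
      (linking-small n h (<⇒≤ hi) (3 * q) K (proj₂ decay₁ h (≤-trans (≤-trans (m≤m+n _ _) (n≤1+n _)) h≥)))

    rare₂ : 3 * q * count 𝒯 F₂ ≤ length 𝒯
    rare₂ = cancel-rare (17 ^ h) X₂ (16 ^ h) (count 𝒯 F₂) (length 𝒯) (3 * q)
      {{m^n≢0 17 h}} (Alternation.alternation-fails-rare n k w h room)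
      (alternation-small n h (<⇒≤ hi) (3 * q) (proj₂ decay₂ h (≤-trans (≤-trans (m≤n+m _ _) (n≤1+n _)) h≥)))

theorem2p1 : (k : ℕ) → 2 ≤ k → (λ n → Prℛ n k {P = Good} good?) ⟶ 1ℚ
theorem2p1 k 2≤k = Prℛ⟶1 k (λ n → good? {n} {k}) (bad-rare k {{>-nonZero (≤-trans (s≤s z≤n) 2≤k)}})
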